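{- Let $k=3$ and let $0<r<3/2$ be a constant. Then there is a constant $c>0$, depending only on $r$, such that for every prime $n>3$, a random $k$-AP-NAE-SAT formula with $n$ variables and $m=\lfloor rn\rfloor$ clauses is satisfiable (i.e. has an NAE-satisfying truth assignment) with probability at least $c$.
   Context: Let $n$ be a prime and $k<n$. The variables are $x_0,\dots,x_{n-1}$, with indices taken modulo $n$; a literal is a variable or its negation. A random $k$-AP-NAE-SAT formula with $n$ variables and $m$ clauses consists of $m$ clauses chosen independently and uniformly at random, with replacement, from the $2^k n^2$ possible clauses. Each clause is determined as follows: $a,b\in\{0,1,\dots,n-1\}$ are chosen independently and uniformly at random, the $k$ variables of the clause (in order) are $x_a,x_{a+b},x_{a+2b},\dots,x_{a+(k-1)b}$ with indices modulo $n$, and each of the $k$ positions is independently negated or not with probability $1/2$ each. Trivial progressions ($b=0$) are allowed, and $(a,a+b,\dots,a+(k-1)b)$ and its reversal count as distinct progressions. A truth assignment NAE-satisfies a formula if, in every clause, at least one literal evaluates to true and at least one literal evaluates to false. The formula is satisfiable if some truth assignment NAE-satisfies it. -}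

module Defs where

open import Data.Bool.Base using (Bool; true; false; not; if_then_else_)
import Data.Bool.Properties as Bool
open import Data.Fin.Base using (Fin; toℕ)
open import Data.Fin.Properties using (nonZeroIndex)
open import Data.Fin.Subset.Properties using (anySubset?)
open import Data.Integer.Base using (+_)
open import Data.List.Base as List
  using (List; []; _∷_; length; filter; allFin; cartesianProduct; cartesianProductWith)
open import Data.List.Properties using (length-++; length-map; length-tabulate)
open import Data.Nat.Base as ℕ using (ℕ; zero; suc; NonZero)
open import Data.Nat.DivMod using (_mod_)
import Data.Nat.Properties as ℕ
open import Data.Product.Base using (∃; ∃-syntax; _×_; _,_; proj₁; proj₂)
open import Data.Rational.Base as ℚ using (ℚ; 0ℚ; 1ℚ; Positive; 1/_)
import Data.Rational.Properties as ℚ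
open import Data.Sum.Base using (_⊎_)
import Data.Sum.Base as Sum
open import Data.Vec.Base as Vec using (Vec; []; _∷_; lookup; zip; tabulate)
open import Data.Vec.Relation.Unary.All as All using (All)
open import Data.Vec.Relation.Unary.Any as Any using (Any)
open import Function.Base using (id)
open import Relation.Binary.PropositionalEquality
open import Relation.Nullary using (¬_; yes; no)
open import Relation.Nullary.Decidable using (_×-dec_)
open import Relation.Unary using (Decidable)

-- Dedekind cuts (L , U).

record ℝ : Set₁ where
  field
    L U       : ℚ → Set
    inhabited : ∃ L × ∃ U
    L-down    : ∀ {p q} → p ℚ.< q → L q → L p
    L-open    : ∀ {p} → L p → ∃[ q ] p ℚ.< q × L q
    U-up      : ∀ {p q} → p ℚ.< q → U p → U q
    U-open    : ∀ {q} → U q → ∃[ p ] p ℚ.< q × U p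
    disjoint  : ∀ {q} → L q → ¬ U q
    located   : ∀ {p q} → p ℚ.< q → L p ⊎ U q

open ℝ

infix 4 _<_ _≤_

_<_ : ℝ → ℝ → Set
x < y = ∃[ q ] U x q × L y q

_≤_ : ℝ → ℝ → Set
x ≤ y = ∀ {q} → L x q → L y q

fromℚ : ℚ → ℝ
fromℚ x = record
  { L         = ℚ._< x
  ; U         = x ℚ.<_
  ; inhabited = (x ℚ.- 1ℚ , below) , (x ℚ.+ 1ℚ , above)
  ; L-down    = ℚ.<-trans
  ; L-open    = λ p<x → let (q , p<q , q<x) = ℚ.<-dense p<x in q , p<q , q<x
  ; U-up      = λ p<q x<p → ℚ.<-trans x<p p<q
  ; U-open    = λ x<q → let (p , x<p , p<q) = ℚ.<-dense x<q in p , p<q , x<p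
  ; disjoint  = ℚ.<-asym
  ; located   = loc
  }
  where
  below : x ℚ.- 1ℚ ℚ.< x
  below = subst (x ℚ.- 1ℚ ℚ.<_) (ℚ.+-identityʳ x)
            (ℚ.+-monoʳ-< x (ℚ.negative⁻¹ (ℚ.- 1ℚ)))

  above : x ℚ.< x ℚ.+ 1ℚ
  above = subst (ℚ._< x ℚ.+ 1ℚ) (ℚ.+-identityʳ x)
            (ℚ.+-monoʳ-< x (ℚ.positive⁻¹ 1ℚ))

  loc : ∀ {p q} → p ℚ.< q → (p ℚ.< x) ⊎ (x ℚ.< q)
  loc {p} p<q with p ℚ.<? x
  ... | yes p<x = Sum.inj₁ p<x
  ... | no  p≮x = Sum.inj₂ (ℚ.≤-<-trans (ℚ.≮⇒≥ p≮x) p<q)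

fromℕ : ℕ → ℝ
fromℕ n = fromℚ (+ n ℚ./ 1)

-- Multiplication of a real by a positive rational: q < x · s iff q / s < x.

infixl 7 _·_

_·_ : ℝ → (s : ℚ) .{{_ : Positive s}} → ℝ
x · s = record
  { L         = λ q → L x (q ℚ.* s⁻¹)
  ; U         = λ q → U x (q ℚ.* s⁻¹)
  ; inhabited = (proj₁ l ℚ.* s , subst (L x) (sym (cancel _)) (proj₂ l))
              , (proj₁ u ℚ.* s , subst (U x) (sym (cancel _)) (proj₂ u))
  ; L-down    = λ p<q → L-down x (mono p<q)
  ; L-open    = λ Lp → let (q , p<q , Lq) = L-open x Lp in
                  q ℚ.* s
                  , subst (ℚ._< q ℚ.* s) (cancel′ _) (ℚ.*-monoˡ-<-pos s p<q)
                  , subst (L x) (sym (cancel q)) Lq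
  ; U-up      = λ p<q → U-up x (mono p<q)
  ; U-open    = λ Uq → let (p , p<q , Up) = U-open x Uq in
                  p ℚ.* s
                  , subst (p ℚ.* s ℚ.<_) (cancel′ _) (ℚ.*-monoˡ-<-pos s p<q)
                  , subst (U x) (sym (cancel p)) Up
  ; disjoint  = disjoint x
  ; located   = λ p<q → located x (mono p<q)
  }
  where
  instance
    s≢0 : ℚ.NonZero s
    s≢0 = ℚ.pos⇒nonZero s

  s⁻¹ : ℚ
  s⁻¹ = 1/ s

  instance
    s⁻¹>0 : Positive s⁻¹
    s⁻¹>0 = ℚ.1/pos⇒pos s

  l = proj₁ (inhabited x)
  u = proj₂ (inhabited x)

  mono : ∀ {p q} → p ℚ.< q → p ℚ.* s⁻¹ ℚ.< q ℚ.* s⁻¹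
  mono = ℚ.*-monoˡ-<-pos s⁻¹

  cancel : ∀ q → q ℚ.* s ℚ.* s⁻¹ ≡ q
  cancel q = trans (ℚ.*-assoc q s s⁻¹)
               (trans (cong (q ℚ.*_) (ℚ.*-inverseʳ s)) (ℚ.*-identityʳ q))

  cancel′ : ∀ q → q ℚ.* s⁻¹ ℚ.* s ≡ q
  cancel′ q = trans (ℚ.*-assoc q s⁻¹ s)
                (trans (cong (q ℚ.*_) (ℚ.*-inverseˡ s)) (ℚ.*-identityʳ q))

-- The floor is a relation because it is not computable on Dedekind reals.

_IsFloorOf_ : ℕ → ℝ → Set
m IsFloorOf x = fromℕ m ≤ x × x < fromℕ (suc m)

instance
  n/1>0 : ∀ {n} .{{_ : NonZero n}} → Positive (+ n ℚ./ 1)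
  n/1>0 {n} = ℚ.normalize-pos n 1

-- The uniform distribution on the entries of Ω, with multiplicity.

Pr : ∀ {A : Set} {P : A → Set} (Ω : List A) .{{_ : NonZero (length Ω)}} →
     Decidable P → ℚ
Pr Ω P? = + length (filter P? Ω) ℚ./ length Ω

Assignment : ℕ → Set
Assignment n = Vec Bool n

-- Polarity false means negated.

Literal : ℕ → Set
Literal n = Fin n × Bool

eval : ∀ {n} → Assignment n → Literal n → Bool
eval σ (i , polarity) = if polarity then lookup σ i else not (lookup σ i)

-- (a , b , polarities): first term and common difference of the
-- progression, and the polarity at each of the k positions.

Clause : ℕ → ℕ → Set
Clause k n = Fin n × Fin n × Vec Bool k

term : ∀ {n} → Fin n → Fin n → ℕ → Fin n
term {n} a b j = (toℕ a ℕ.+ j ℕ.* toℕ b) mod n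
  where instance _ = nonZeroIndex a

literals : ∀ {k n} → Clause k n → Vec (Literal n) k
literals (a , b , polarities) = zip (tabulate λ j → term a b (toℕ j)) polarities

NAE : ∀ {k n} → Assignment n → Clause k n → Set
NAE σ C = Any (λ ℓ → eval σ ℓ ≡ true) (literals C)
        × Any (λ ℓ → eval σ ℓ ≡ false) (literals C)

Formula : ℕ → ℕ → ℕ → Set
Formula k n m = Vec (Clause k n) m

NAESatisfies : ∀ {k n m} → Assignment n → Formula k n m → Set
NAESatisfies σ F = All (NAE σ) F

Satisfiable : ∀ {k n m} → Formula k n m → Set
Satisfiable {n = n} F = ∃[ σ ] NAESatisfies {n = n} σ F

satisfiable? : ∀ {k n m} → Decidable (Satisfiable {k} {n} {m})
satisfiable? F = anySubset? λ σ → All.all? (nae? σ) F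
  where
  nae? : ∀ {k n} (σ : Assignment n) → Decidable (NAE {k} σ)
  nae? σ C = Any.any? (λ ℓ → eval σ ℓ Bool.≟ true) (literals C)
       ×-dec Any.any? (λ ℓ → eval σ ℓ Bool.≟ false) (literals C)

vectors : ∀ {A : Set} m → List A → List (Vec A m)
vectors zero    xs = [] ∷ []
vectors (suc m) xs = cartesianProductWith _∷_ xs (vectors m xs)

clauses : ∀ k n → List (Clause k n)
clauses k n = cartesianProduct (allFin n)
  (cartesianProduct (allFin n) (vectors k (true ∷ false ∷ [])))

formulas : ∀ k n m → List (Formula k n m)
formulas k n m = vectors m (clauses k n)

length-cartesianProductWith :
  ∀ {A B C : Set} (f : A → B → C) xs ys →
  length (cartesianProductWith f xs ys) ≡ length xs ℕ.* length ys
length-cartesianProductWith f []       ys = refl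
length-cartesianProductWith f (x ∷ xs) ys = trans (length-++ (List.map (f x) ys))
  (cong₂ ℕ._+_ (length-map (f x) ys) (length-cartesianProductWith f xs ys))

length-vectors : ∀ {A : Set} m (xs : List A) →
                 length (vectors m xs) ≡ length xs ℕ.^ m
length-vectors zero    xs = refl
length-vectors (suc m) xs = trans
  (length-cartesianProductWith _∷_ xs (vectors m xs))
  (cong (length xs ℕ.*_) (length-vectors m xs))

length-clauses : ∀ k n → length (clauses k n) ≡ n ℕ.* (n ℕ.* 2 ℕ.^ k)
length-clauses k n = begin
  length (clauses k n)
    ≡⟨ length-cartesianProductWith _,_ (allFin n) (cartesianProduct (allFin n) polarities) ⟩
  length (allFin n) ℕ.* length (cartesianProduct (allFin n) polarities)
    ≡⟨ cong (length (allFin n) ℕ.*_) (length-cartesianProductWith _,_ (allFin n) polarities) ⟩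
  length (allFin n) ℕ.* (length (allFin n) ℕ.* length polarities)
    ≡⟨ cong₂ (λ x y → x ℕ.* (x ℕ.* y)) (length-tabulate {n = n} id) (length-vectors k _) ⟩
  n ℕ.* (n ℕ.* 2 ℕ.^ k) ∎
  where
  open ≡-Reasoning
  polarities = vectors k (true ∷ false ∷ [])

length-formulas : ∀ k n m →
                  length (formulas k n m) ≡ (n ℕ.* (n ℕ.* 2 ℕ.^ k)) ℕ.^ m
length-formulas k n m = trans (length-vectors m (clauses k n))
                              (cong (ℕ._^ m) (length-clauses k n))

formulas≢0 : ∀ k n m .{{_ : NonZero n}} → NonZero (length (formulas k n m))
formulas≢0 k n m = subst NonZero (sym (length-formulas k n m))
  (ℕ.m^n≢0 (n ℕ.* (n ℕ.* 2 ℕ.^ k)) m)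
  where
  instance
    2^k≢0 : NonZero (2 ℕ.^ k)
    2^k≢0 = ℕ.m^n≢0 2 k

    n*2^k≢0 : NonZero (n ℕ.* 2 ℕ.^ k)
    n*2^k≢0 = ℕ.m*n≢0 n (2 ℕ.^ k)

    n*n*2^k≢0 : NonZero (n ℕ.* (n ℕ.* 2 ℕ.^ k))
    n*n*2^k≢0 = ℕ.m*n≢0 n (n ℕ.* 2 ℕ.^ k)

-- The uniform distribution on sequences of m clauses is that of m
-- independent uniform clauses, drawn with replacement.

Pr-satisfiable : ∀ k n m .{{_ : NonZero n}} → ℚ
Pr-satisfiable k n m = Pr (formulas k n m) {{formulas≢0 k n m}} satisfiable?

{-# OPTIONS --safe #-}

-- Second moment method on the number X of NAE-satisfying assignments.  Since
-- n is odd, any two of the three positions of a uniform progression are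
-- independent uniform elements of ℤ/n, so the number of clauses that σ and τ
-- both satisfy depends only on their agreement S = Σ ±1: it is
-- (9n² + 3S²) / 2.  With S a sum of n independent signs this gives
-- E[X²] / E[X]² = E[(1 + S²/3n²)ᵐ].  Stein's identity for sums of signs and
-- the convexity of s²ʲ bound the moments of S by
-- E S²ʲ⁺² ≤ 2n(j+1) E S²ʲ, so for m ≤ ρn the ratio is at most the geometric
-- series 1 / (1 − 2ρ/3), where ρ is a rational between r and 3/2.

module Submission where

open import Data.Bool.Base using (Bool; true; false; if_then_else_; not)
open import Data.Fin.Base using (Fin; zero; suc; toℕ)
open import Data.Fin.Permutation using (Permutation′; permutation; _⟨$⟩ʳ_)
open import Data.Fin.Properties using (toℕ-fromℕ<; toℕ-injective; toℕ<n)
open import Data.Integer.Base as ℤ using (ℤ; +_; 0ℤ; 1ℤ; -1ℤ; _+_; _*_; -_; _^_; +≤+)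
import Data.Integer.Properties as ℤ
open import Data.Integer.Tactic.RingSolver using (solve-∀)
open import Data.List.Base as List
  using (List; []; _∷_; _++_; length; filter; allFin; cartesianProduct; cartesianProductWith)
open import Data.List.Properties using (length-tabulate)
open import Data.Nat.Base as ℕ using (ℕ; zero; suc; z≤n; s≤s; NonZero)
open import Data.Nat.Divisibility using (m%n≡0⇒n∣m)
open import Data.Nat.DivMod
  using (_/_; _%_; _mod_; m≡m%n+[m/n]*n; m%n%n≡m%n; [m+n]%n≡m%n; %-distribˡ-+; %-distribˡ-*; m<n⇒m%n≡m; m%n<n)
open import Data.Nat.Primality using (Prime; prime⇒irreducible)
import Data.Nat.Properties as ℕ
import Data.Nat.Tactic.RingSolver as ℕ-solver
open import Data.Product.Base using (∃-syntax; _×_; _,_)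
open import Data.Rational.Base as ℚ using (0ℚ; 1/_; toℚᵘ; ↥_; ↧_; ↧ₙ_)
import Data.Rational.Properties as ℚ
open import Data.Rational.Unnormalised.Base as ℚᵘ using (mkℚᵘ; *≤*)
import Data.Rational.Unnormalised.Properties as ℚᵘ
open import Data.Sum.Base using (_⊎_; inj₁; inj₂)
open import Data.Vec.Base as Vec using (Vec; []; _∷_; lookup)
open import Data.Vec.Relation.Unary.All using ([]; _∷_)
open import Data.Vec.Relation.Unary.Any using (Any; here; there)
import Data.Vec.Relation.Unary.Any.Properties as Any
open import Defs
open import Function.Base using (_∘_; id)
open import Relation.Binary.PropositionalEquality
open import Relation.Nullary using (¬_; Dec; yes; no; does; contradiction)
open import Relation.Nullary.Decidable using (from-yes; map′; _×-dec_)
open import Relation.Unary using (Decidable)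
open import Algebra.Properties.CommutativeMonoid.Sum ℤ.+-0-commutativeMonoid using (sum; sum-permute)

-- Signs, powers and inequalities of integers

*-nonneg : ∀ {i j} → 0ℤ ℤ.≤ i → 0ℤ ℤ.≤ j → 0ℤ ℤ.≤ i * j
*-nonneg {+ m} {+ n} _ _ = subst (0ℤ ℤ.≤_) (ℤ.pos-* m n) (+≤+ z≤n)

+-nonneg : ∀ {i j} → 0ℤ ℤ.≤ i → 0ℤ ℤ.≤ j → 0ℤ ℤ.≤ i + j
+-nonneg = ℤ.+-mono-≤

*-monoʳ-≤ : ∀ {k i j} → 0ℤ ℤ.≤ k → i ℤ.≤ j → k * i ℤ.≤ k * j
*-monoʳ-≤ {k} k≥0 = ℤ.*-monoˡ-≤-nonNeg k {{ℤ.nonNegative k≥0}}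

square-nonneg : ∀ i → 0ℤ ℤ.≤ i * i
square-nonneg (+ n)       = *-nonneg {+ n} {+ n} (+≤+ z≤n) (+≤+ z≤n)
square-nonneg ℤ.-[1+ n ] = +≤+ z≤n

^-nonneg : ∀ {i} m → 0ℤ ℤ.≤ i → 0ℤ ℤ.≤ i ^ m
^-nonneg zero    i≥0 = +≤+ z≤n
^-nonneg (suc m) i≥0 = *-nonneg i≥0 (^-nonneg m i≥0)

^-distrib-* : ∀ i j m → (i * j) ^ m ≡ i ^ m * j ^ m
^-distrib-* i j zero    = refl
^-distrib-* i j (suc m) = trans (cong (i * j *_) (^-distrib-* i j m)) (lemma i j (i ^ m) (j ^ m))
  where
  lemma : ∀ i j x y → i * j * (x * y) ≡ i * x * (j * y)
  lemma = solve-∀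

-- Turns an inequality into a ring identity whose surplus term is visibly nonnegative, so that the
-- ring solver does the algebra.
≤-from-diff : ∀ {i j k} → 0ℤ ℤ.≤ k → j ≡ i + k → i ℤ.≤ j
≤-from-diff {i} k≥0 refl = subst (ℤ._≤ i + _) (ℤ.+-identityʳ i) (ℤ.+-monoʳ-≤ i k≥0)

-- Powers are monotone on nonnegative integers, so the two factors never have opposite signs. The
-- induction avoids comparing a with b by writing a^(j+1) - b^(j+1) = a (a^j - b^j) + (a - b) b^j.
chebyshev : ∀ {a b} j → 0ℤ ℤ.≤ a → 0ℤ ℤ.≤ b → 0ℤ ℤ.≤ (a + - b) * (a ^ j + - b ^ j)
chebyshev {a} {b} zero    a≥0 b≥0 = ℤ.≤-reflexive (sym (ℤ.*-zeroʳ (a + - b)))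
chebyshev {a} {b} (suc j) a≥0 b≥0 = subst (0ℤ ℤ.≤_) (sym (lemma a b (a ^ j) (b ^ j)))
  (+-nonneg (*-nonneg a≥0 (chebyshev j a≥0 b≥0))
            (*-nonneg (square-nonneg (a + - b)) (^-nonneg j b≥0)))
  where
  lemma : ∀ a b x y → (a + - b) * (a * x + - (b * y))
                    ≡ a * ((a + - b) * (x + - y)) + (a + - b) * (a + - b) * y
  lemma = solve-∀

*-pos : ∀ {i j} → 0ℤ ℤ.< i → 0ℤ ℤ.< j → 0ℤ ℤ.< i * j
*-pos {i} {j} i>0 j>0 = subst (ℤ._< i * j) (ℤ.*-zeroʳ i) (ℤ.*-monoˡ-<-pos i {{ℤ.positive i>0}} j>0)

^-pos : ∀ {i} m → 0ℤ ℤ.< i → 0ℤ ℤ.< i ^ m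
^-pos zero    i>0 = ℤ.+<+ (s≤s z≤n)
^-pos (suc m) i>0 = *-pos i>0 (^-pos m i>0)

pos-^ : ∀ k m → + (k ℕ.^ m) ≡ (+ k) ^ m
pos-^ k zero    = refl
pos-^ k (suc m) = trans (ℤ.pos-* k (k ℕ.^ m)) (cong (+ k *_) (pos-^ k m))

-- Moments of sums of signs

-- The trapezoid rule for the convex function x^(2j) on [s - 1, s + 1], an interval of length 2: it
-- overestimates the integral, which bounds the difference of x^(2j+1) at the ends by 2j+1 times the
-- sum of the end values. Here 2j+1 is relaxed to 2(j+1).
trapezoid : ∀ s j → (1ℤ + s) * ((1ℤ + s) * (1ℤ + s)) ^ j + - ((-1ℤ + s) * ((-1ℤ + s) * (-1ℤ + s)) ^ j)
          ℤ.≤ + 2 * + suc j * (((1ℤ + s) * (1ℤ + s)) ^ j + ((-1ℤ + s) * (-1ℤ + s)) ^ j)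
trapezoid s zero = ≤-from-diff {k = + 2} (+≤+ z≤n) (lemma s)
  where
  lemma : ∀ s → + 2 * 1ℤ * (1ℤ + 1ℤ) ≡ (1ℤ + s) * 1ℤ + - ((-1ℤ + s) * 1ℤ) + + 2
  lemma = solve-∀
-- With a, b the two squares and x, y their j-th powers, doubling allows 2 (a x + b y) to be written
-- as (a + b) (x + y) + (a - b) (x - y). The surplus is then a multiple of the Chebyshev product, a
-- + b times the slack of the induction hypothesis, and 4 (x + y).
trapezoid s (suc j) = ℤ.*-cancelˡ-≤-pos _ _ (+ 2) (≤-from-diff
  (+-nonneg (+-nonneg
    (*-nonneg (+-nonneg {+ 2 * + suc j} {1ℤ} (+≤+ z≤n) (+≤+ z≤n)) (chebyshev j a≥0 b≥0))
    (*-nonneg (+-nonneg a≥0 b≥0) (ℤ.i≤j⇒0≤j-i (trapezoid s j))))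
    (*-nonneg {+ 4} (+≤+ z≤n) (+-nonneg (^-nonneg j a≥0) (^-nonneg j b≥0))))
  (lemma s (+ suc j) (((1ℤ + s) * (1ℤ + s)) ^ j) (((-1ℤ + s) * (-1ℤ + s)) ^ j)))
  where
  a≥0 = square-nonneg (1ℤ + s)
  b≥0 = square-nonneg (-1ℤ + s)
  lemma : ∀ s c x y → let u = 1ℤ + s; v = -1ℤ + s; a = u * u; b = v * v in
    + 2 * (+ 2 * (1ℤ + c) * (a * x + b * y)) ≡
    + 2 * (u * (a * x) + - (v * (b * y))) +
    ((+ 2 * c + 1ℤ) * ((a + - b) * (x + - y)) + (a + b) * (+ 2 * c * (x + y) + - (u * x + - (v * y))) + + 4 * (x + y))
  lemma = solve-∀

-- The unnormalised expectation 2ⁿ E f(S), where S is a sum of n independent uniform signs. Keeping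
-- the factor 2ⁿ keeps all values in ℤ.
walkSum : ℕ → (ℤ → ℤ) → ℤ
walkSum zero    f = f 0ℤ
walkSum (suc n) f = walkSum n (λ s → f (1ℤ + s)) + walkSum n (λ s → f (-1ℤ + s))

walkSum-cong : ∀ n {f g} → (∀ s → f s ≡ g s) → walkSum n f ≡ walkSum n g
walkSum-cong zero    f≗g = f≗g 0ℤ
walkSum-cong (suc n) f≗g = cong₂ _+_ (walkSum-cong n λ s → f≗g _) (walkSum-cong n λ s → f≗g _)

walkSum-mono : ∀ n {f g} → (∀ s → f s ℤ.≤ g s) → walkSum n f ℤ.≤ walkSum n g
walkSum-mono zero    f≤g = f≤g 0ℤ
walkSum-mono (suc n) f≤g = ℤ.+-mono-≤ (walkSum-mono n λ s → f≤g _) (walkSum-mono n λ s → f≤g _)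

+-interchange : ∀ a b c d → (a + b) + (c + d) ≡ (a + c) + (b + d)
+-interchange = solve-∀

walkSum-+ : ∀ n f g → walkSum n (λ s → f s + g s) ≡ walkSum n f + walkSum n g
walkSum-+ zero    f g = refl
walkSum-+ (suc n) f g = trans (cong₂ _+_ (walkSum-+ n _ _) (walkSum-+ n _ _))
  (+-interchange (walkSum n (λ s → f (1ℤ + s))) (walkSum n (λ s → g (1ℤ + s))) _ _)

walkSum-* : ∀ n c f → walkSum n (λ s → c * f s) ≡ c * walkSum n f
walkSum-* zero    c f = refl
walkSum-* (suc n) c f = trans (cong₂ _+_ (walkSum-* n c _) (walkSum-* n c _))
  (sym (ℤ.*-distribˡ-+ c (walkSum n (λ s → f (1ℤ + s))) _))

walkSum-1 : ∀ n → walkSum n (λ _ → 1ℤ) ≡ (+ 2) ^ n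
walkSum-1 zero    = refl
walkSum-1 (suc n) = trans (cong (λ x → x + x) (walkSum-1 n)) (lemma ((+ 2) ^ n))
  where
  lemma : ∀ x → x + x ≡ + 2 * x
  lemma = solve-∀

-- Discrete integration by parts. When the factor s is written as a sum of signs, all signs
-- contribute equally by symmetry, and summing out one of them leaves the difference of f at the two
-- neighbours of the sum of the others. In the induction, the sign that is split off contributes `d`
-- and the remaining ones are handled by the hypothesis for `h`.
stein : ∀ n f → walkSum (suc n) (λ s → s * f s)
              ≡ + suc n * walkSum n (λ s → f (1ℤ + s) + - f (-1ℤ + s))
stein zero f = lemma (f 1ℤ) (f -1ℤ)
  where
  lemma : ∀ x y → 1ℤ * x + -1ℤ * y ≡ 1ℤ * (x + - y)
  lemma = solve-∀
stein (suc n) f = begin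
  walkSum (suc n) (λ s → (1ℤ + s) * f (1ℤ + s)) + walkSum (suc n) (λ s → (-1ℤ + s) * f (-1ℤ + s))
    ≡⟨ walkSum-+ (suc n) (λ s → (1ℤ + s) * f (1ℤ + s)) (λ s → (-1ℤ + s) * f (-1ℤ + s)) ⟨
  walkSum (suc n) (λ s → (1ℤ + s) * f (1ℤ + s) + (-1ℤ + s) * f (-1ℤ + s))
    ≡⟨ walkSum-cong (suc n) (λ s → expand s (f (1ℤ + s)) (f (-1ℤ + s))) ⟩
  walkSum (suc n) (λ s → s * h s + d s)
    ≡⟨ walkSum-+ (suc n) (λ s → s * h s) d ⟩
  walkSum (suc n) (λ s → s * h s) + walkSum (suc n) d
    ≡⟨ cong (_+ walkSum (suc n) d) (stein n h) ⟩
  + suc n * walkSum n (λ s → h (1ℤ + s) + - h (-1ℤ + s)) + walkSum (suc n) d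
    ≡⟨ cong (λ x → + suc n * x + walkSum (suc n) d) telescope ⟩
  + suc n * walkSum (suc n) d + walkSum (suc n) d
    ≡⟨ collect (+ suc n) (walkSum (suc n) d) ⟩
  + suc (suc n) * walkSum (suc n) d ∎
  where
  open ≡-Reasoning
  h d : ℤ → ℤ
  h s = f (1ℤ + s) + f (-1ℤ + s)
  d s = f (1ℤ + s) + - f (-1ℤ + s)

  expand : ∀ s x y → (1ℤ + s) * x + (-1ℤ + s) * y ≡ s * (x + y) + (x + - y)
  expand = solve-∀

  cancel : ∀ x y z → x + y + - (y + z) ≡ x + - y + (y + - z)
  cancel = solve-∀

  swap : ∀ s → 1ℤ + (-1ℤ + s) ≡ -1ℤ + (1ℤ + s)
  swap = solve-∀

  collect : ∀ k x → k * x + x ≡ (1ℤ + k) * x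
  collect = solve-∀

  -- The two copies of f s cancel in the difference of `h`. Reinserted with opposite signs, they
  -- make it the sum of `d` at s + 1 and at s - 1.
  telescope : walkSum n (λ s → h (1ℤ + s) + - h (-1ℤ + s)) ≡ walkSum (suc n) d
  telescope = trans
    (walkSum-cong n λ s → trans
      (cong (λ t → f (1ℤ + (1ℤ + s)) + f (-1ℤ + (1ℤ + s)) + - (f t + f (-1ℤ + (-1ℤ + s)))) (swap s))
      (trans (cancel (f (1ℤ + (1ℤ + s))) (f (-1ℤ + (1ℤ + s))) _)
             (cong (λ t → d (1ℤ + s) + (f t + - f (-1ℤ + (-1ℤ + s)))) (sym (swap s)))))
    (walkSum-+ n (λ s → d (1ℤ + s)) (λ s → d (-1ℤ + s)))

-- The Gaussian moment growth E S^(2j+2) ≤ (2j+1) n E S^(2j), with 2j+2 for 2j+1.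
moment-growth : ∀ n j → walkSum n (λ s → (s * s) ^ suc j)
                      ℤ.≤ + 2 * + n * + suc j * walkSum n (λ s → (s * s) ^ j)
moment-growth zero    j = +≤+ z≤n
moment-growth (suc n) j = begin
  walkSum (suc n) (λ s → (s * s) ^ suc j)
    ≡⟨ walkSum-cong (suc n) (λ s → ℤ.*-assoc s s ((s * s) ^ j)) ⟩
  walkSum (suc n) (λ s → s * (s * (s * s) ^ j))
    ≡⟨ stein n (λ s → s * (s * s) ^ j) ⟩
  + suc n * walkSum n (λ s → (1ℤ + s) * e (1ℤ + s) + - ((-1ℤ + s) * e (-1ℤ + s)))
    ≤⟨ *-monoʳ-≤ {+ suc n} (+≤+ z≤n) (walkSum-mono n λ s → trapezoid s j) ⟩
  + suc n * walkSum n (λ s → + 2 * + suc j * (e (1ℤ + s) + e (-1ℤ + s)))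
    ≡⟨ cong (+ suc n *_) (trans (walkSum-* n (+ 2 * + suc j) _) (cong (+ 2 * + suc j *_) (walkSum-+ n (λ s → e (1ℤ + s)) _))) ⟩
  + suc n * (+ 2 * + suc j * walkSum (suc n) e)
    ≡⟨ lemma (+ suc n) (+ suc j) (walkSum (suc n) e) ⟩
  + 2 * + suc n * + suc j * walkSum (suc n) e ∎
  where
  open ℤ.≤-Reasoning
  e : ℤ → ℤ
  e s = (s * s) ^ j
  lemma : ∀ n j x → n * (+ 2 * j * x) ≡ + 2 * n * j * x
  lemma = solve-∀

-- Powers of `A + S²`

module _ (n : ℕ) (A : ℤ) (A≥0 : 0ℤ ℤ.≤ A) where

  -- For A = 3n² and i = 0 this is the sum to which the second moment reduces. The exponent i stays
  -- free because the induction for `weighted-growth` uses i and i + 1 together.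
  weighted : ℕ → ℕ → ℤ
  weighted m i = walkSum n (λ s → (s * s) ^ i * (A + s * s) ^ m)

  -- The part of the derivative of xⁱ (A + x)ᵐ that differentiates (A + x)ᵐ.
  weighted′ : ℕ → ℕ → ℤ
  weighted′ zero    i = 0ℤ
  weighted′ (suc m) i = + suc m * weighted m i

  weighted-suc : ∀ m i → weighted (suc m) i ≡ A * weighted m i + weighted m (suc i)
  weighted-suc m i = trans
    (walkSum-cong n λ s → lemma (s * s) A ((s * s) ^ i) ((A + s * s) ^ m))
    (trans (walkSum-+ n (λ s → A * ((s * s) ^ i * (A + s * s) ^ m)) _)
           (cong (_+ weighted m (suc i)) (walkSum-* n A _)))
    where
    lemma : ∀ x A p q → p * ((A + x) * q) ≡ A * (p * q) + x * p * q
    lemma = solve-∀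

  -- Multiplying the derivative m (A + x)^(m-1) by A + x gives m (A + x)^m.
  weighted′-suc : ∀ m i → A * weighted′ m i + weighted′ m (suc i) ≡ + m * weighted m i
  weighted′-suc zero    i = cong (_+ 0ℤ) (ℤ.*-zeroʳ A)
  weighted′-suc (suc m) i = trans (lemma A (+ suc m) (weighted m i) (weighted m (suc i)))
                                  (cong (+ suc m *_) (sym (weighted-suc m i)))
    where
    lemma : ∀ A k x y → A * (k * x) + k * y ≡ k * (A * x + y)
    lemma = solve-∀

  -- moment-growth bounds x^(i+1) by 2n times its derivative in x = S²;
  -- hence the same holds for x^(i+1) (A + x)^m.
  weighted-growth : ∀ m i → weighted m (suc i)
                          ℤ.≤ + 2 * + n * (+ suc i * weighted m i + weighted′ m (suc i))
  weighted-growth zero i = begin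
    weighted zero (suc i)
      ≡⟨ walkSum-cong n (λ s → ℤ.*-identityʳ ((s * s) ^ suc i)) ⟩
    walkSum n (λ s → (s * s) ^ suc i)
      ≤⟨ moment-growth n i ⟩
    + 2 * + n * + suc i * walkSum n (λ s → (s * s) ^ i)
      ≡⟨ cong (+ 2 * + n * + suc i *_) (walkSum-cong n (λ s → sym (ℤ.*-identityʳ ((s * s) ^ i)))) ⟩
    + 2 * + n * + suc i * weighted zero i
      ≡⟨ lemma (+ n) (+ suc i) (weighted zero i) ⟩
    + 2 * + n * (+ suc i * weighted zero i + 0ℤ) ∎
    where
    open ℤ.≤-Reasoning
    lemma : ∀ n i x → + 2 * n * i * x ≡ + 2 * n * (i * x + 0ℤ)
    lemma = solve-∀
  weighted-growth (suc m) i = begin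
    weighted (suc m) (suc i)
      ≡⟨ weighted-suc m (suc i) ⟩
    A * weighted m (suc i) + weighted m (suc (suc i))
      ≤⟨ ℤ.+-mono-≤ (*-monoʳ-≤ A≥0 (weighted-growth m i)) (weighted-growth m (suc i)) ⟩
    A * (+ 2 * + n * (+ suc i * weighted m i + weighted′ m (suc i)))
    + + 2 * + n * (+ suc (suc i) * weighted m (suc i) + weighted′ m (suc (suc i)))
      ≡⟨ lemma A (+ n) (+ suc i) (weighted m i) (weighted m (suc i)) (weighted′ m (suc i)) _ ⟩
    + 2 * + n * (+ suc i * (A * weighted m i + weighted m (suc i))
                + (weighted m (suc i) + (A * weighted′ m (suc i) + weighted′ m (suc (suc i)))))
      ≡⟨ cong₂ (λ x y → + 2 * + n * (+ suc i * x + (weighted m (suc i) + y)))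
           (sym (weighted-suc m i)) (weighted′-suc m (suc i)) ⟩
    + 2 * + n * (+ suc i * weighted (suc m) i + (weighted m (suc i) + + m * weighted m (suc i)))
      ≡⟨ cong (λ x → + 2 * + n * (+ suc i * weighted (suc m) i + x)) (collect (+ m) (weighted m (suc i))) ⟩
    + 2 * + n * (+ suc i * weighted (suc m) i + weighted′ (suc m) (suc i)) ∎
    where
    open ℤ.≤-Reasoning
    lemma : ∀ A n i x y u v →
      A * (+ 2 * n * (i * x + u)) + + 2 * n * ((1ℤ + i) * y + v)
      ≡ + 2 * n * (i * (A * x + y) + (y + (A * u + v)))
    lemma = solve-∀
    collect : ∀ m x → x + m * x ≡ (1ℤ + m) * x
    collect = solve-∀

  -- One factor A + x is split: the part with A falls to the induction hypothesis, the part with x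
  -- to `weighted-growth` at i = 0. The result is a recursion that bounds the m-th power by Aᵐ plus
  -- 2nm times the power before it.
  weighted-bound : ∀ m → weighted m 0 ℤ.≤ (+ 2) ^ n * A ^ m + + 2 * + n * weighted′ m 0
  weighted-bound zero = ℤ.≤-reflexive (trans (walkSum-1 n) (lemma ((+ 2) ^ n) (+ n)))
    where
    lemma : ∀ x n → x ≡ x * 1ℤ + + 2 * n * 0ℤ
    lemma = solve-∀
  weighted-bound (suc m) = begin
    weighted (suc m) 0
      ≡⟨ weighted-suc m 0 ⟩
    A * weighted m 0 + weighted m 1
      ≤⟨ ℤ.+-mono-≤ (*-monoʳ-≤ A≥0 (weighted-bound m)) (weighted-growth m 0) ⟩
    A * ((+ 2) ^ n * A ^ m + + 2 * + n * weighted′ m 0)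
    + + 2 * + n * (1ℤ * weighted m 0 + weighted′ m 1)
      ≡⟨ lemma A ((+ 2) ^ n) (A ^ m) (+ n) (weighted m 0) (weighted′ m 0) _ ⟩
    (+ 2) ^ n * (A * A ^ m) + + 2 * + n * (weighted m 0 + (A * weighted′ m 0 + weighted′ m 1))
      ≡⟨ cong (λ x → (+ 2) ^ n * (A * A ^ m) + + 2 * + n * (weighted m 0 + x)) (weighted′-suc m 0) ⟩
    (+ 2) ^ n * (A * A ^ m) + + 2 * + n * (weighted m 0 + + m * weighted m 0)
      ≡⟨ cong (λ x → (+ 2) ^ n * (A * A ^ m) + + 2 * + n * x) (collect (+ m) (weighted m 0)) ⟩
    (+ 2) ^ n * A ^ suc m + + 2 * + n * weighted′ (suc m) 0 ∎
    where
    open ℤ.≤-Reasoning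
    lemma : ∀ A t p n x u v →
      A * (t * p + + 2 * n * u) + + 2 * n * (1ℤ * x + v)
      ≡ t * (A * p) + + 2 * n * (x + (A * u + v))
    lemma = solve-∀
    collect : ∀ m x → x + m * x ≡ (1ℤ + m) * x
    collect = solve-∀

  -- Iterating weighted-bound gives a geometric series with ratio 2nM / A ≤ 1 − e / f.
  geometric-bound : ∀ {e f M} → 0ℤ ℤ.≤ e → e ℤ.≤ f → + 2 * + n * + M * f ℤ.≤ (f + - e) * A →
                    ∀ m → m ℕ.≤ M → e * weighted m 0 ℤ.≤ f * ((+ 2) ^ n * A ^ m)
  geometric-bound {e} {f} e≥0 e≤f _ zero _ = begin
    e * weighted 0 0           ≡⟨ cong (e *_) (walkSum-1 n) ⟩
    e * (+ 2) ^ n              ≤⟨ ℤ.*-monoʳ-≤-nonNeg _ {{ℤ.nonNegative (^-nonneg {+ 2} n (+≤+ z≤n))}} e≤f ⟩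
    f * (+ 2) ^ n              ≡⟨ cong (f *_) (ℤ.*-identityʳ _) ⟨
    f * ((+ 2) ^ n * A ^ zero) ∎
    where open ℤ.≤-Reasoning
  geometric-bound {e} {f} {M} e≥0 e≤f ratio (suc m) m<M = begin
    e * weighted (suc m) 0
      ≤⟨ *-monoʳ-≤ e≥0 (weighted-bound (suc m)) ⟩
    e * (t * A ^ suc m + + 2 * + n * (+ suc m * weighted m 0))
      ≡⟨ lemma₁ e (t * A ^ suc m) (+ n) (+ suc m) (weighted m 0) ⟩
    e * (t * A ^ suc m) + + 2 * + n * + suc m * (e * weighted m 0)
      ≤⟨ ℤ.+-monoʳ-≤ (e * (t * A ^ suc m)) (*-monoʳ-≤ {+ 2 * + n * + suc m} 2nm≥0
           (geometric-bound e≥0 e≤f ratio m (ℕ.<⇒≤ m<M))) ⟩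
    e * (t * A ^ suc m) + + 2 * + n * + suc m * (f * (t * A ^ m))
      ≤⟨ ℤ.+-monoʳ-≤ (e * (t * A ^ suc m)) (ℤ.*-monoʳ-≤-nonNeg (f * (t * A ^ m)) {{ℤ.nonNegative ftA≥0}}
           (*-monoʳ-≤ {+ 2 * + n} (*-nonneg {+ 2} {+ n} (+≤+ z≤n) (+≤+ z≤n)) (+≤+ m<M))) ⟩
    e * (t * A ^ suc m) + + 2 * + n * + M * (f * (t * A ^ m))
      ≡⟨ cong (λ x → e * (t * A ^ suc m) + x) (ℤ.*-assoc (+ 2 * + n * + M) f _) ⟨
    e * (t * A ^ suc m) + + 2 * + n * + M * f * (t * A ^ m)
      ≤⟨ ℤ.+-monoʳ-≤ (e * (t * A ^ suc m)) (ℤ.*-monoʳ-≤-nonNeg (t * A ^ m) {{ℤ.nonNegative tA≥0}} ratio) ⟩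
    e * (t * A ^ suc m) + (f + - e) * A * (t * A ^ m)
      ≡⟨ lemma₂ e f t A (A ^ m) ⟩
    f * (t * A ^ suc m) ∎
    where
    open ℤ.≤-Reasoning
    t = (+ 2) ^ n
    tA≥0 : 0ℤ ℤ.≤ t * A ^ m
    tA≥0 = *-nonneg (^-nonneg {+ 2} n (+≤+ z≤n)) (^-nonneg m A≥0)
    ftA≥0 : 0ℤ ℤ.≤ f * (t * A ^ m)
    ftA≥0 = *-nonneg (ℤ.≤-trans e≥0 e≤f) tA≥0
    2nm≥0 : 0ℤ ℤ.≤ + 2 * + n * + suc m
    2nm≥0 = *-nonneg (*-nonneg {+ 2} {+ n} (+≤+ z≤n) (+≤+ z≤n)) (+≤+ z≤n)
    lemma₁ : ∀ e x n m w → e * (x + + 2 * n * (m * w)) ≡ e * x + + 2 * n * m * (e * w)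
    lemma₁ = solve-∀
    lemma₂ : ∀ e f t A p → e * (t * (A * p)) + (f + - e) * A * (t * p) ≡ f * (t * (A * p))
    lemma₂ = solve-∀

-- Finite sums and the second moment inequality

private variable
  A B C : Set

∑ : List A → (A → ℤ) → ℤ
∑ []       f = 0ℤ
∑ (x ∷ xs) f = f x + ∑ xs f

∑-cong : ∀ (xs : List A) {f g} → (∀ x → f x ≡ g x) → ∑ xs f ≡ ∑ xs g
∑-cong []       f≗g = refl
∑-cong (x ∷ xs) f≗g = cong₂ _+_ (f≗g x) (∑-cong xs f≗g)

∑-mono : ∀ (xs : List A) {f g} → (∀ x → f x ℤ.≤ g x) → ∑ xs f ℤ.≤ ∑ xs g
∑-mono []       f≤g = ℤ.≤-refl
∑-mono (x ∷ xs) f≤g = ℤ.+-mono-≤ (f≤g x) (∑-mono xs f≤g)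

∑-+ : ∀ (xs : List A) f g → ∑ xs (λ x → f x + g x) ≡ ∑ xs f + ∑ xs g
∑-+ []       f g = refl
∑-+ (x ∷ xs) f g = trans (cong (_+_ (f x + g x)) (∑-+ xs f g)) (+-interchange (f x) (g x) _ _)

∑-* : ∀ (xs : List A) c f → ∑ xs (λ x → c * f x) ≡ c * ∑ xs f
∑-* []       c f = sym (ℤ.*-zeroʳ c)
∑-* (x ∷ xs) c f = trans (cong (_+_ (c * f x)) (∑-* xs c f)) (sym (ℤ.*-distribˡ-+ c (f x) _))

∑-*ʳ : ∀ (xs : List A) f c → ∑ xs (λ x → f x * c) ≡ ∑ xs f * c
∑-*ʳ xs f c = trans (∑-cong xs λ x → ℤ.*-comm (f x) c)
                    (trans (∑-* xs c f) (ℤ.*-comm c (∑ xs f)))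

∑-const : ∀ (xs : List A) c → ∑ xs (λ _ → c) ≡ + length xs * c
∑-const []       c = refl
∑-const (x ∷ xs) c = trans (cong (_+_ c) (∑-const xs c)) (lemma c (+ length xs))
  where
  lemma : ∀ c n → c + n * c ≡ (1ℤ + n) * c
  lemma = solve-∀

∑-swap : ∀ (xs : List A) (ys : List B) (f : A → B → ℤ) →
         ∑ xs (λ x → ∑ ys (f x)) ≡ ∑ ys (λ y → ∑ xs (λ x → f x y))
∑-swap []       ys f = sym (trans (∑-const ys 0ℤ) (ℤ.*-zeroʳ (+ length ys)))
∑-swap (x ∷ xs) ys f = trans (cong (_+_ (∑ ys (f x))) (∑-swap xs ys f))
                             (sym (∑-+ ys (f x) (λ y → ∑ xs (λ x → f x y))))

∑-product : ∀ (xs : List A) (ys : List B) f g →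
            ∑ xs f * ∑ ys g ≡ ∑ xs (λ x → ∑ ys (λ y → f x * g y))
∑-product xs ys f g = trans (sym (∑-*ʳ xs f (∑ ys g))) (∑-cong xs λ x → sym (∑-* ys (f x) g))

∑-++ : ∀ (xs ys : List A) f → ∑ (xs ++ ys) f ≡ ∑ xs f + ∑ ys f
∑-++ []       ys f = sym (ℤ.+-identityˡ _)
∑-++ (x ∷ xs) ys f = trans (cong (_+_ (f x)) (∑-++ xs ys f)) (sym (ℤ.+-assoc (f x) _ _))

∑-map : ∀ (h : A → B) xs f → ∑ (List.map h xs) f ≡ ∑ xs (f ∘ h)
∑-map h []       f = refl
∑-map h (x ∷ xs) f = cong (_+_ (f (h x))) (∑-map h xs f)

∑-cartesianProductWith : ∀ (h : A → B → C) xs ys f →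
  ∑ (cartesianProductWith h xs ys) f ≡ ∑ xs (λ x → ∑ ys (λ y → f (h x y)))
∑-cartesianProductWith h []       ys f = refl
∑-cartesianProductWith h (x ∷ xs) ys f = trans
  (∑-++ (List.map (h x) ys) (cartesianProductWith h xs ys) f)
  (cong₂ _+_ (∑-map (h x) ys f) (∑-cartesianProductWith h xs ys f))

-- The bridge to `sum`, whose invariance under permutations gives `∑-permute`.
∑-tabulate : ∀ {n} (g : Fin n → A) f → ∑ (List.tabulate g) f ≡ sum (f ∘ g)
∑-tabulate {n = zero}  g f = refl
∑-tabulate {n = suc n} g f = cong (_+_ (f (g zero))) (∑-tabulate (g ∘ suc) f)

∏ : ∀ {m} → (A → ℤ) → Vec A m → ℤ
∏ g []       = 1ℤ
∏ g (x ∷ xs) = g x * ∏ g xs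

∏-* : ∀ {m} (f g : A → ℤ) (xs : Vec A m) → ∏ (λ x → f x * g x) xs ≡ ∏ f xs * ∏ g xs
∏-* f g []       = refl
∏-* f g (x ∷ xs) = trans (cong (f x * g x *_) (∏-* f g xs)) (lemma (f x) (g x) (∏ f xs) (∏ g xs))
  where
  lemma : ∀ a b x y → a * b * (x * y) ≡ a * x * (b * y)
  lemma = solve-∀

-- Independence of the m clauses: expanding the power of the sum over one clause gives one product
-- for each vector.
∑-∏ : ∀ m (xs : List A) g → ∑ (vectors m xs) (∏ g) ≡ ∑ xs g ^ m
∑-∏ zero    xs g = refl
∑-∏ (suc m) xs g = begin
  ∑ (vectors (suc m) xs) (∏ g)
    ≡⟨ ∑-cartesianProductWith _∷_ xs (vectors m xs) (∏ g) ⟩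
  ∑ xs (λ x → ∑ (vectors m xs) (λ v → g x * ∏ g v))
    ≡⟨ ∑-product xs (vectors m xs) g (∏ g) ⟨
  ∑ xs g * ∑ (vectors m xs) (∏ g)
    ≡⟨ cong (∑ xs g *_) (∑-∏ m xs g) ⟩
  ∑ xs g ^ suc m ∎
  where open ≡-Reasoning

module _ {P : A → Set} (P? : Decidable P) where

  indicator : A → ℤ
  indicator x = if does (P? x) then 1ℤ else 0ℤ

  ∑-indicator : ∀ xs → ∑ xs indicator ≡ + length (filter P? xs)
  ∑-indicator []       = refl
  ∑-indicator (x ∷ xs) with does (P? x)
  ... | true  = cong (_+_ 1ℤ) (∑-indicator xs)
  ... | false = trans (ℤ.+-identityˡ _) (∑-indicator xs)

  -- Cauchy–Schwarz for X = X · indicator: expand Σ (u X − v · indicator)² ≥ 0 at u = e ΣX, v = Q.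
  cauchy-schwarz : ∀ (xs : List A) (X : A → ℤ) {e Q} → (∀ {x} → ¬ P x → X x ≡ 0ℤ) →
                  0ℤ ℤ.≤ e → 0ℤ ℤ.< Q → e * ∑ xs (λ x → X x * X x) ℤ.≤ Q →
                  e * (∑ xs X * ∑ xs X) ℤ.≤ Q * + length (filter P? xs)
  cauchy-schwarz xs X {e} {Q} X≡0 e≥0 Q>0 eq≤Q =
    ℤ.*-cancelˡ-≤-pos _ _ Q {{ℤ.positive Q>0}}
      (ℤ.i-j≤0⇒i≤j (subst (ℤ._≤ 0ℤ) (rearrange e s Q N)
        (ℤ.i≤j⇒i-j≤0 (begin
          + 2 * (e * s * Q) * s            ≡⟨ ∑-* xs (+ 2 * (e * s * Q)) X ⟨
          ∑ xs (λ x → + 2 * (e * s * Q) * X x)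
                                           ≤⟨ ∑-mono xs pointwise ⟩
          ∑ xs (λ x → e * s * (e * s) * (X x * X x) + Q * Q * indicator x)
                                           ≡⟨ ∑-+ xs _ _ ⟩
          ∑ xs (λ x → e * s * (e * s) * (X x * X x)) + ∑ xs (λ x → Q * Q * indicator x)
                                           ≡⟨ cong₂ _+_ (∑-* xs (e * s * (e * s)) _)
                                                (trans (∑-* xs (Q * Q) indicator) (cong (Q * Q *_) (∑-indicator xs))) ⟩
          e * s * (e * s) * q + Q * Q * N  ≡⟨ cong (_+ Q * Q * N) (regroup e s q) ⟩
          e * (s * s) * (e * q) + Q * Q * N
                                           ≤⟨ ℤ.+-monoˡ-≤ (Q * Q * N) (*-monoʳ-≤ (*-nonneg e≥0 (square-nonneg s)) eq≤Q) ⟩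
          e * (s * s) * Q + Q * Q * N      ∎))))
    where
    open ℤ.≤-Reasoning
    s = ∑ xs X
    q = ∑ xs (λ x → X x * X x)
    N = + length (filter P? xs)

    rearrange : ∀ e s Q N → + 2 * (e * s * Q) * s + - (e * (s * s) * Q + Q * Q * N)
                          ≡ Q * (e * (s * s)) + - (Q * (Q * N))
    rearrange = solve-∀

    regroup : ∀ e s q → e * s * (e * s) * q ≡ e * (s * s) * (e * q)
    regroup = solve-∀

    square : ∀ u v x → u * u * (x * x) + v * v * 1ℤ
                     ≡ + 2 * (u * v) * x + (u * x + - v) * (u * x + - v)
    square = solve-∀

    vanish : ∀ u v → u * u * (0ℤ * 0ℤ) + v * v * 0ℤ ≡ + 2 * (u * v) * 0ℤ + 0ℤ
    vanish = solve-∀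

    pointwise : ∀ x → + 2 * (e * s * Q) * X x
                      ℤ.≤ e * s * (e * s) * (X x * X x) + Q * Q * indicator x
    pointwise x with P? x
    ... | yes _  = ≤-from-diff (square-nonneg (e * s * X x + - Q)) (square (e * s) Q (X x))
    ... | no  ¬p rewrite X≡0 ¬p = ≤-from-diff ℤ.≤-refl (vanish (e * s) Q)

-- Progressions and clauses

∑-permute : ∀ {n} (π : Permutation′ n) f → ∑ (allFin n) (λ i → f (π ⟨$⟩ʳ i)) ≡ ∑ (allFin n) f
∑-permute π f = trans (∑-tabulate id (λ i → f (π ⟨$⟩ʳ i)))
                      (trans (sym (sum-permute f π)) (sym (∑-tabulate id f)))

module _ {n : ℕ} .{{_ : NonZero n}} where

  +-cong-% : ∀ {a b c d} → a % n ≡ b % n → c % n ≡ d % n → (a ℕ.+ c) % n ≡ (b ℕ.+ d) % n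
  +-cong-% {a} {b} {c} {d} p q = trans (%-distribˡ-+ a c n)
    (trans (cong₂ (λ x y → (x ℕ.+ y) % n) p q) (sym (%-distribˡ-+ b d n)))

  *-cong-% : ∀ {a b c d} → a % n ≡ b % n → c % n ≡ d % n → (a ℕ.* c) % n ≡ (b ℕ.* d) % n
  *-cong-% {a} {b} {c} {d} p q = trans (%-distribˡ-* a c n)
    (trans (cong₂ (λ x y → (x ℕ.* y) % n) p q) (sym (%-distribˡ-* b d n)))

  toℕ-mod : ∀ m → toℕ (m mod n) ≡ m % n
  toℕ-mod m = toℕ-fromℕ< (m%n<n m n)

  mod-cong : ∀ {a b} → a % n ≡ b % n → a mod n ≡ b mod n
  mod-cong {a} {b} p = toℕ-injective (trans (toℕ-mod a) (trans p (sym (toℕ-mod b))))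

  toℕ-mod-% : ∀ m → toℕ (m mod n) % n ≡ m % n
  toℕ-mod-% m = trans (cong (_% n) (toℕ-mod m)) (m%n%n≡m%n m n)

  mod-toℕ : ∀ {m} i → m % n ≡ toℕ i % n → m mod n ≡ i
  mod-toℕ {m} i p = toℕ-injective (trans (toℕ-mod m) (trans p (m<n⇒m%n≡m (toℕ<n i))))

  -- As h inverts j modulo n, the map b ↦ a + j b is undone by subtracting a and multiplying by h.
  -- So, for a fixed first term, the term at position j is uniform.
  term-permutation : ∀ (a : Fin n) j h → (j ℕ.* h) % n ≡ 1 % n → Permutation′ n
  term-permutation a j h jh≡1 = permutation (λ b → term a b j) inverse f∘g g∘f
    where
    open ≡-Reasoning
    -- A representative of -a modulo n; the truncated subtraction is exact because a < n.
    -a = n ℕ.∸ toℕ a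

    inverse : Fin n → Fin n
    inverse c = (h ℕ.* (toℕ c ℕ.+ -a)) mod n

    a-a≡n : toℕ a ℕ.+ -a ≡ n
    a-a≡n = ℕ.m+[n∸m]≡n (ℕ.<⇒≤ (toℕ<n a))

    f∘g : ∀ c → term a (inverse c) j ≡ c
    f∘g c = mod-toℕ c (begin
      (toℕ a ℕ.+ j ℕ.* toℕ (inverse c)) % n
        ≡⟨ +-cong-% {toℕ a} refl (*-cong-% {j} refl (toℕ-mod-% (h ℕ.* (toℕ c ℕ.+ -a)))) ⟩
      (toℕ a ℕ.+ j ℕ.* (h ℕ.* (toℕ c ℕ.+ -a))) % n
        ≡⟨ +-cong-% {toℕ a} refl (trans (cong (_% n) (sym (ℕ.*-assoc j h _))) (*-cong-% {j ℕ.* h} jh≡1 refl)) ⟩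
      (toℕ a ℕ.+ 1 ℕ.* (toℕ c ℕ.+ -a)) % n
        ≡⟨ cong (_% n) (lemma (toℕ a) (toℕ c) -a) ⟩
      (toℕ c ℕ.+ (toℕ a ℕ.+ -a)) % n
        ≡⟨ cong (λ x → (toℕ c ℕ.+ x) % n) a-a≡n ⟩
      (toℕ c ℕ.+ n) % n
        ≡⟨ [m+n]%n≡m%n (toℕ c) n ⟩
      toℕ c % n ∎)
      where
      lemma : ∀ a c x → a ℕ.+ 1 ℕ.* (c ℕ.+ x) ≡ c ℕ.+ (a ℕ.+ x)
      lemma = ℕ-solver.solve-∀

    g∘f : ∀ b → inverse (term a b j) ≡ b
    g∘f b = mod-toℕ b (begin
      (h ℕ.* (toℕ (term a b j) ℕ.+ -a)) % n
        ≡⟨ *-cong-% {h} refl (+-cong-% (toℕ-mod-% (toℕ a ℕ.+ j ℕ.* toℕ b)) refl) ⟩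
      (h ℕ.* (toℕ a ℕ.+ j ℕ.* toℕ b ℕ.+ -a)) % n
        ≡⟨ cong (λ x → (h ℕ.* x) % n) (lemma₁ (toℕ a) (j ℕ.* toℕ b) -a) ⟩
      (h ℕ.* (j ℕ.* toℕ b ℕ.+ (toℕ a ℕ.+ -a))) % n
        ≡⟨ cong (λ x → (h ℕ.* (j ℕ.* toℕ b ℕ.+ x)) % n) a-a≡n ⟩
      (h ℕ.* (j ℕ.* toℕ b ℕ.+ n)) % n
        ≡⟨ *-cong-% {h} refl ([m+n]%n≡m%n (j ℕ.* toℕ b) n) ⟩
      (h ℕ.* (j ℕ.* toℕ b)) % n
        ≡⟨ cong (_% n) (lemma₂ h j (toℕ b)) ⟩
      (j ℕ.* h ℕ.* toℕ b) % n
        ≡⟨ *-cong-% {j ℕ.* h} jh≡1 refl ⟩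
      (1 ℕ.* toℕ b) % n
        ≡⟨ cong (_% n) (ℕ.*-identityˡ (toℕ b)) ⟩
      toℕ b % n ∎)
      where
      lemma₁ : ∀ a x y → a ℕ.+ x ℕ.+ y ≡ x ℕ.+ (a ℕ.+ y)
      lemma₁ = ℕ-solver.solve-∀
      lemma₂ : ∀ h j b → h ℕ.* (j ℕ.* b) ≡ j ℕ.* h ℕ.* b
      lemma₂ = ℕ-solver.solve-∀

  term-0 : ∀ (a b : Fin n) → term a b 0 ≡ a
  term-0 a b = mod-toℕ a (cong (_% n) (ℕ.+-identityʳ (toℕ a)))

  -- Lets `term-permutation`, which varies the difference, act on the first term instead.
  term-comm : ∀ (a b : Fin n) → term a b 1 ≡ term b a 1
  term-comm a b = mod-cong (cong (_% n) (lemma (toℕ a) (toℕ b)))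
    where
    lemma : ∀ a b → a ℕ.+ 1 ℕ.* b ≡ b ℕ.+ 1 ℕ.* a
    lemma = ℕ-solver.solve-∀

  term-2 : ∀ (a b : Fin n) → term (term a b 1) b 1 ≡ term a b 2
  term-2 a b = mod-cong (trans
    (+-cong-% (toℕ-mod-% (toℕ a ℕ.+ 1 ℕ.* toℕ b)) refl)
    (cong (_% n) (lemma (toℕ a) (toℕ b))))
    where
    lemma : ∀ a b → a ℕ.+ 1 ℕ.* b ℕ.+ 1 ℕ.* b ≡ a ℕ.+ 2 ℕ.* b
    lemma = ℕ-solver.solve-∀

  module _ (d : Fin n → ℤ) where

    private
      is = allFin n
      D = ∑ is d

    -- For each a, the term at position j runs once through ℤ/n as b varies, so the inner sum is d a
    -- times D.
    correlation-0j : ∀ j h → (j ℕ.* h) % n ≡ 1 % n →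
                     ∑ is (λ a → ∑ is (λ b → d a * d (term a b j))) ≡ D * D
    correlation-0j j h jh≡1 = trans
      (∑-cong is λ a → trans (∑-* is (d a) (λ b → d (term a b j)))
        (cong (d a *_) (∑-permute (term-permutation a j h jh≡1) d)))
      (∑-*ʳ is d D)

    -- For each b, the shift of a by b is a permutation that turns positions 1 and 2 into positions
    -- 0 and 1.
    correlation-12 : ∑ is (λ a → ∑ is (λ b → d (term a b 1) * d (term a b 2))) ≡ D * D
    correlation-12 = begin
      ∑ is (λ a → ∑ is (λ b → d (term a b 1) * d (term a b 2)))
        ≡⟨ ∑-swap is is _ ⟩
      ∑ is (λ b → ∑ is (λ a → d (term a b 1) * d (term a b 2)))
        ≡⟨ ∑-cong is (λ b → ∑-cong is λ a → trans
             (cong (λ x → d (term a b 1) * d x) (sym (term-2 a b)))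
             (cong (λ x → d x * d (term x b 1)) (term-comm a b))) ⟩
      ∑ is (λ b → ∑ is (λ a → d (term b a 1) * d (term (term b a 1) b 1)))
        ≡⟨ ∑-cong is (λ b → ∑-permute (term-permutation b 1 1 refl) (λ x → d x * d (term x b 1))) ⟩
      ∑ is (λ b → ∑ is (λ a → d a * d (term a b 1)))
        ≡⟨ ∑-swap is is _ ⟩
      ∑ is (λ a → ∑ is (λ b → d a * d (term a b 1)))
        ≡⟨ correlation-0j 1 1 refl ⟩
      D * D ∎
      where open ≡-Reasoning

-- Polarities and pairs of assignments

bools : List Bool
bools = true ∷ false ∷ []

-- Allows the identities for sums over the eight polarity patterns to be settled by evaluating all
-- cases.
∀-Bool? : {P : Bool → Set} → Decidable P → Dec (∀ b → P b)
∀-Bool? P? = map′ (λ { (t , f) → λ { true → t ; false → f } }) (λ p → p true , p false)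
                  (P? true ×-dec P? false)

-- The product of the two truth values read as ±1: 1 for agreement and -1 for disagreement.
spin : Bool → Bool → ℤ
spin true  true  = 1ℤ
spin true  false = -1ℤ
spin false true  = -1ℤ
spin false false = 1ℤ

nae : Vec Bool 3 → ℤ
nae (true  ∷ true  ∷ true  ∷ []) = 0ℤ
nae (false ∷ false ∷ false ∷ []) = 0ℤ
nae _                            = 1ℤ

signed : Vec Bool 3 → Vec Bool 3 → Vec Bool 3
signed = Vec.zipWith λ x polarity → if polarity then x else not x

-- Of the eight polarity patterns, exactly two make the three literals equal.
∑-nae : ∀ x y z → ∑ (vectors 3 bools) (λ ps → nae (signed (x ∷ y ∷ z ∷ []) ps)) ≡ + 6
∑-nae = from-yes (∀-Bool? λ x → ∀-Bool? λ y → ∀-Bool? λ z →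
  ∑ (vectors 3 bools) (λ ps → nae (signed (x ∷ y ∷ z ∷ []) ps)) ℤ.≟ + 6)

-- In ±1 terms nae x y z = (3 − xy − yz − xz) / 4, and summing over the polarities
-- kills every mixed product except those where the polarities square away.
∑-nae-nae : ∀ x y z x′ y′ z′ →
  + 2 * ∑ (vectors 3 bools) (λ ps → nae (signed (x ∷ y ∷ z ∷ []) ps) * nae (signed (x′ ∷ y′ ∷ z′ ∷ []) ps))
  ≡ + 9 + (spin x x′ * spin y y′ + (spin y y′ * spin z z′ + spin x x′ * spin z z′))
∑-nae-nae = from-yes (∀-Bool? λ x → ∀-Bool? λ y → ∀-Bool? λ z → ∀-Bool? λ x′ → ∀-Bool? λ y′ → ∀-Bool? λ z′ →
  + 2 * ∑ (vectors 3 bools) (λ ps → nae (signed (x ∷ y ∷ z ∷ []) ps) * nae (signed (x′ ∷ y′ ∷ z′ ∷ []) ps))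
  ℤ.≟ + 9 + (spin x x′ * spin y y′ + (spin y y′ * spin z z′ + spin x x′ * spin z z′)))

nae-sound : ∀ bs → nae bs ≡ 0ℤ ⊎ Any (_≡ true) bs × Any (_≡ false) bs
nae-sound (true  ∷ true  ∷ true  ∷ []) = inj₁ refl
nae-sound (false ∷ false ∷ false ∷ []) = inj₁ refl
nae-sound (true  ∷ false ∷ _     ∷ []) = inj₂ (here refl , there (here refl))
nae-sound (false ∷ true  ∷ _     ∷ []) = inj₂ (there (here refl) , here refl)
nae-sound (true  ∷ true  ∷ false ∷ []) = inj₂ (here refl , there (there (here refl)))
nae-sound (false ∷ false ∷ true  ∷ []) = inj₂ (there (there (here refl)) , here refl)

clauseValue : ∀ {n} → Assignment n → Clause 3 n → ℤ
clauseValue σ C = nae (Vec.map (eval σ) (literals C))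

formulaValue-sound : ∀ {n m} (σ : Assignment n) (F : Formula 3 n m) →
                     ∏ (clauseValue σ) F ≡ 0ℤ ⊎ NAESatisfies {n = n} σ F
formulaValue-sound σ [] = inj₂ []
formulaValue-sound σ (C ∷ F) with nae-sound (Vec.map (eval σ) (literals C)) | formulaValue-sound σ F
... | inj₁ C≡0 | _        = inj₁ (cong (_* ∏ (clauseValue σ) F) C≡0)
... | inj₂ _   | inj₁ F≡0 = inj₁ (trans (cong (clauseValue σ C *_) F≡0) (ℤ.*-zeroʳ (clauseValue σ C)))
... | inj₂ (t , f) | inj₂ Fs = inj₂ ((Any.map⁻ t , Any.map⁻ f) ∷ Fs)

∑-clauses : ∀ n (f : Clause 3 n → ℤ) →
  ∑ (clauses 3 n) f ≡ ∑ (allFin n) (λ a → ∑ (allFin n) (λ b → ∑ (vectors 3 bools) (λ ps → f (a , b , ps))))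
∑-clauses n f = trans
  (∑-cartesianProductWith _,_ (allFin n) (cartesianProduct (allFin n) (vectors 3 bools)) f)
  (∑-cong (allFin n) λ a → ∑-cartesianProductWith _,_ (allFin n) (vectors 3 bools) (λ C → f (a , C)))

∑∑-const : ∀ n c → ∑ (allFin n) (λ _ → ∑ (allFin n) (λ _ → c)) ≡ c * (+ n * + n)
∑∑-const n c = begin
  ∑ (allFin n) (λ _ → ∑ (allFin n) (λ _ → c))
    ≡⟨ ∑-const (allFin n) (∑ (allFin n) (λ _ → c)) ⟩
  + length (allFin n) * ∑ (allFin n) (λ _ → c)
    ≡⟨ cong (+ length (allFin n) *_) (∑-const (allFin n) c) ⟩
  + length (allFin n) * (+ length (allFin n) * c)
    ≡⟨ cong (λ l → + l * (+ l * c)) (length-tabulate {n = n} id) ⟩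
  + n * (+ n * c)
    ≡⟨ lemma (+ n) c ⟩
  c * (+ n * + n) ∎
  where
  open ≡-Reasoning
  lemma : ∀ n c → n * (n * c) ≡ c * (n * n)
  lemma = solve-∀

clauseValue-sum : ∀ {n} (σ : Assignment n) →
                  ∑ (clauses 3 n) (clauseValue σ) ≡ + 6 * (+ n * + n)
clauseValue-sum {n} σ = begin
  ∑ (clauses 3 n) (clauseValue σ)
    ≡⟨ ∑-clauses n (clauseValue σ) ⟩
  ∑ (allFin n) (λ a → ∑ (allFin n) (λ b → ∑ (vectors 3 bools) (λ ps → clauseValue σ (a , b , ps))))
    ≡⟨ ∑-cong (allFin n) (λ a → ∑-cong (allFin n) λ b →
         ∑-nae (lookup σ (term a b 0)) (lookup σ (term a b 1)) (lookup σ (term a b 2))) ⟩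
  ∑ (allFin n) (λ _ → ∑ (allFin n) (λ _ → + 6))
    ≡⟨ ∑∑-const n (+ 6) ⟩
  + 6 * (+ n * + n) ∎
  where open ≡-Reasoning

agreement : ∀ {n} → Assignment n → Assignment n → ℤ
agreement σ τ = sum (λ i → spin (lookup σ i) (lookup τ i))

-- By `∑-nae-nae` only products over pairs of positions remain besides the constant 9, and each pair
-- contributes the squared agreement. For positions 0 and 2 this uses h as the inverse of 2 modulo
-- n. The factor 2 clears the denominator of (9n² + 3S²) / 2.
clauseValue-correlation : ∀ {n h} .{{_ : NonZero n}} → 2 ℕ.* h ≡ suc n → (σ τ : Assignment n) →
  + 2 * ∑ (clauses 3 n) (λ C → clauseValue σ C * clauseValue τ C)
  ≡ + 9 * (+ n * + n) + + 3 * (agreement σ τ * agreement σ τ)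
clauseValue-correlation {n} {h} 2h≡1+n σ τ = begin
  + 2 * ∑ (clauses 3 n) (λ C → clauseValue σ C * clauseValue τ C)
    ≡⟨ cong (+ 2 *_) (∑-clauses n _) ⟩
  + 2 * ∑ is (λ a → ∑ is (λ b → g a b))
    ≡⟨ trans (sym (∑-* is (+ 2) _)) (∑-cong is λ a → sym (∑-* is (+ 2) (g a))) ⟩
  ∑ is (λ a → ∑ is (λ b → + 2 * g a b))
    ≡⟨ ∑-cong is (λ a → ∑-cong is λ b → trans
         (∑-nae-nae (lookup σ (term a b 0)) (lookup σ (term a b 1)) (lookup σ (term a b 2))
                    (lookup τ (term a b 0)) (lookup τ (term a b 1)) (lookup τ (term a b 2)))
         (cong (λ x → + 9 + (d x * d (term a b 1) + (d (term a b 1) * d (term a b 2) + d x * d (term a b 2))))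
               (term-0 a b))) ⟩
  ∑ is (λ a → ∑ is (λ b → + 9 + (c₀₁ a b + (c₁₂ a b + c₀₂ a b))))
    ≡⟨ ∑∑-+ (λ _ _ → + 9) (λ a b → c₀₁ a b + (c₁₂ a b + c₀₂ a b)) ⟩
  ∑ is (λ _ → ∑ is (λ _ → + 9)) + ∑ is (λ a → ∑ is (λ b → c₀₁ a b + (c₁₂ a b + c₀₂ a b)))
    ≡⟨ cong₂ _+_ (∑∑-const n (+ 9))
         (trans (∑∑-+ c₀₁ (λ a b → c₁₂ a b + c₀₂ a b)) (cong (_+_ (∑ is (λ a → ∑ is (c₀₁ a)))) (∑∑-+ c₁₂ c₀₂))) ⟩
  + 9 * (+ n * + n) + (∑ is (λ a → ∑ is (c₀₁ a)) + (∑ is (λ a → ∑ is (c₁₂ a)) + ∑ is (λ a → ∑ is (c₀₂ a))))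
    ≡⟨ cong (_+_ (+ 9 * (+ n * + n))) (cong₂ _+_ (correlation-0j d 1 1 refl)
         (cong₂ _+_ (correlation-12 d) (correlation-0j d 2 h 2h≡1))) ⟩
  + 9 * (+ n * + n) + (∑ is d * ∑ is d + (∑ is d * ∑ is d + ∑ is d * ∑ is d))
    ≡⟨ cong (_+_ (+ 9 * (+ n * + n))) (lemma (∑ is d)) ⟩
  + 9 * (+ n * + n) + + 3 * (∑ is d * ∑ is d)
    ≡⟨ cong (λ x → + 9 * (+ n * + n) + + 3 * (x * x)) (∑-tabulate id d) ⟩
  + 9 * (+ n * + n) + + 3 * (agreement σ τ * agreement σ τ) ∎
  where
  open ≡-Reasoning
  is = allFin n

  d : Fin n → ℤ
  d i = spin (lookup σ i) (lookup τ i)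

  g c₀₁ c₁₂ c₀₂ : Fin n → Fin n → ℤ
  g a b = ∑ (vectors 3 bools) (λ ps → clauseValue σ (a , b , ps) * clauseValue τ (a , b , ps))
  c₀₁ a b = d a * d (term a b 1)
  c₁₂ a b = d (term a b 1) * d (term a b 2)
  c₀₂ a b = d a * d (term a b 2)

  2h≡1 : (2 ℕ.* h) % n ≡ 1 % n
  2h≡1 = trans (cong (_% n) 2h≡1+n) ([m+n]%n≡m%n 1 n)

  ∑∑-+ : ∀ (u v : Fin n → Fin n → ℤ) →
         ∑ is (λ a → ∑ is (λ b → u a b + v a b)) ≡ ∑ is (λ a → ∑ is (u a)) + ∑ is (λ a → ∑ is (v a))
  ∑∑-+ u v = trans (∑-cong is λ a → ∑-+ is (u a) (v a)) (∑-+ is _ _)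

  lemma : ∀ x → x * x + (x * x + x * x) ≡ + 3 * (x * x)
  lemma = solve-∀

-- For fixed σ, the map from τ to the vector of spins is a bijection onto all sign vectors, so the
-- agreement is distributed as S whatever σ is.
∑-agreement : ∀ {n} (σ : Assignment n) f → ∑ (vectors n bools) (λ τ → f (agreement σ τ)) ≡ walkSum n f
∑-agreement []      f = ℤ.+-identityʳ (f 0ℤ)
∑-agreement {suc n} (x ∷ σ) f = trans
  (∑-cartesianProductWith _∷_ bools (vectors n bools) _)
  (trans (cong₂ _+_ (∑-agreement σ (λ s → f (spin x true + s)))
                    (cong (_+ 0ℤ) (∑-agreement σ (λ s → f (spin x false + s)))))
         (by-cases x))
  where
  by-cases : ∀ x → walkSum n (λ s → f (spin x true + s)) + (walkSum n (λ s → f (spin x false + s)) + 0ℤ)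
                 ≡ walkSum (suc n) f
  by-cases true  = cong (_+_ (walkSum n (λ s → f (1ℤ + s)))) (ℤ.+-identityʳ (walkSum n (λ s → f (-1ℤ + s))))
  -- Here `true` comes first among the values of τ but gives the spin -1, so the two halves of the
  -- walk are exchanged.
  by-cases false = trans
    (cong (_+_ (walkSum n (λ s → f (-1ℤ + s)))) (ℤ.+-identityʳ (walkSum n (λ s → f (1ℤ + s)))))
    (ℤ.+-comm (walkSum n (λ s → f (-1ℤ + s))) _)

-- Moments of the number of solutions

solutions : ∀ {n m} → Formula 3 n m → ℤ
solutions {n} F = ∑ (vectors n bools) (λ σ → ∏ (clauseValue σ) F)

-- Supplies the hypothesis of `cauchy-schwarz` that X vanishes outside the event.
unsatisfiable⇒solutions≡0 : ∀ {n m} {F : Formula 3 n m} → ¬ Satisfiable {n = n} F → solutions {n} F ≡ 0ℤ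
unsatisfiable⇒solutions≡0 {n} {m} {F} unsat = trans
  (∑-cong (vectors n bools) vanish)
  (trans (∑-const (vectors n bools) 0ℤ) (ℤ.*-zeroʳ (+ length (vectors n bools))))
  where
  vanish : ∀ σ → ∏ (clauseValue σ) F ≡ 0ℤ
  vanish σ with formulaValue-sound σ F
  ... | inj₁ F≡0 = F≡0
  ... | inj₂ sat = contradiction (σ , sat) unsat

∑-assignments-const : ∀ n c → ∑ (vectors n bools) (λ _ → c) ≡ (+ 2) ^ n * c
∑-assignments-const n c = trans (∑-const (vectors n bools) c)
  (cong (_* c) (trans (cong +_ (length-vectors n bools)) (pos-^ 2 n)))

-- Linearity of expectation: after the sums are exchanged, every assignment contributes the same
-- power, since it satisfies 6 of the 8 polarity patterns on each of the n² progressions.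
first-moment : ∀ n m → ∑ (formulas 3 n m) solutions ≡ (+ 2) ^ n * (+ 6 * (+ n * + n)) ^ m
first-moment n m = begin
  ∑ (formulas 3 n m) solutions
    ≡⟨ ∑-swap (formulas 3 n m) (vectors n bools) _ ⟩
  ∑ (vectors n bools) (λ σ → ∑ (formulas 3 n m) (∏ (clauseValue σ)))
    ≡⟨ ∑-cong (vectors n bools) (λ σ → trans (∑-∏ m (clauses 3 n) (clauseValue σ))
         (cong (_^ m) (clauseValue-sum σ))) ⟩
  ∑ (vectors n bools) (λ _ → (+ 6 * (+ n * + n)) ^ m)
    ≡⟨ ∑-assignments-const n _ ⟩
  (+ 2) ^ n * (+ 6 * (+ n * + n)) ^ m ∎
  where open ≡-Reasoning

-- X² is a sum over pairs σ, τ. For each pair the clauses are independent and the sum over one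
-- clause is (3/2) (3n² + S²), which gives the factors 2ᵐ and 3ᵐ and the choice A = 3n². Summing
-- over τ turns the agreement into a walk.
second-moment : ∀ {n h} .{{_ : NonZero n}} m → 2 ℕ.* h ≡ suc n → (A≥0 : 0ℤ ℤ.≤ + 3 * (+ n * + n)) →
  (+ 2) ^ m * ∑ (formulas 3 n m) (λ F → solutions F * solutions F)
  ≡ (+ 2) ^ n * ((+ 3) ^ m * weighted n (+ 3 * (+ n * + n)) A≥0 m 0)
second-moment {n} {h} m 2h≡1+n A≥0 = begin
  (+ 2) ^ m * ∑ Fs (λ F → solutions F * solutions F)
    ≡⟨ cong ((+ 2) ^ m *_) (∑-cong Fs λ F → trans (∑-product σs σs _ _)
         (∑-cong σs λ σ → ∑-cong σs λ τ → sym (∏-* (clauseValue σ) (clauseValue τ) F))) ⟩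
  (+ 2) ^ m * ∑ Fs (λ F → ∑ σs (λ σ → ∑ σs (λ τ → ∏ (joint σ τ) F)))
    ≡⟨ cong ((+ 2) ^ m *_) (trans (∑-swap Fs σs _) (∑-cong σs λ σ → ∑-swap Fs σs _)) ⟩
  (+ 2) ^ m * ∑ σs (λ σ → ∑ σs (λ τ → ∑ Fs (∏ (joint σ τ))))
    ≡⟨ trans (sym (∑-* σs ((+ 2) ^ m) _)) (∑-cong σs λ σ → sym (∑-* σs ((+ 2) ^ m) _)) ⟩
  ∑ σs (λ σ → ∑ σs (λ τ → (+ 2) ^ m * ∑ Fs (∏ (joint σ τ))))
    ≡⟨ ∑-cong σs (λ σ → ∑-cong σs (pair σ)) ⟩
  ∑ σs (λ σ → ∑ σs (λ τ → (+ 3) ^ m * g (agreement σ τ)))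
    ≡⟨ ∑-cong σs (λ σ → trans (∑-agreement σ (λ s → (+ 3) ^ m * g s)) (walkSum-* n ((+ 3) ^ m) g)) ⟩
  ∑ σs (λ σ → (+ 3) ^ m * walkSum n g)
    ≡⟨ ∑-assignments-const n _ ⟩
  (+ 2) ^ n * ((+ 3) ^ m * walkSum n g) ∎
  where
  open ≡-Reasoning
  Fs = formulas 3 n m
  σs = vectors n bools

  joint : Assignment n → Assignment n → Clause 3 n → ℤ
  joint σ τ C = clauseValue σ C * clauseValue τ C

  -- The factor `1ℤ` makes `walkSum n g` agree by computation with `weighted` at exponent i = 0.
  g : ℤ → ℤ
  g s = 1ℤ * (+ 3 * (+ n * + n) + s * s) ^ m

  factor : ∀ n s → + 9 * (n * n) + + 3 * (s * s) ≡ + 3 * (+ 3 * (n * n) + s * s)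
  factor = solve-∀

  pair : ∀ σ τ → (+ 2) ^ m * ∑ Fs (∏ (joint σ τ)) ≡ (+ 3) ^ m * g (agreement σ τ)
  pair σ τ = begin
    (+ 2) ^ m * ∑ Fs (∏ (joint σ τ))
      ≡⟨ cong ((+ 2) ^ m *_) (∑-∏ m (clauses 3 n) (joint σ τ)) ⟩
    (+ 2) ^ m * ∑ (clauses 3 n) (joint σ τ) ^ m
      ≡⟨ ^-distrib-* (+ 2) (∑ (clauses 3 n) (joint σ τ)) m ⟨
    (+ 2 * ∑ (clauses 3 n) (joint σ τ)) ^ m
      ≡⟨ cong (_^ m) (trans (clauseValue-correlation {h = h} 2h≡1+n σ τ) (factor (+ n) (agreement σ τ))) ⟩
    (+ 3 * (+ 3 * (+ n * + n) + agreement σ τ * agreement σ τ)) ^ m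
      ≡⟨ ^-distrib-* (+ 3) _ m ⟩
    (+ 3) ^ m * (+ 3 * (+ n * + n) + agreement σ τ * agreement σ τ) ^ m
      ≡⟨ cong ((+ 3) ^ m *_) (ℤ.*-identityˡ _) ⟨
    (+ 3) ^ m * g (agreement σ τ) ∎

-- A satisfying proportion of at least e / f, cleared of denominators: (8n²)ᵐ is the number of
-- formulas. The last hypothesis says that the geometric ratio 2nm / 3n² is at most 1 - e / f.
satisfiable-count : ∀ {n h} m .{{_ : NonZero n}} → 2 ℕ.* h ≡ suc n → ∀ {e f} → 0ℤ ℤ.< e → e ℤ.≤ f →
  + 2 * + n * + m * f ℤ.≤ (f + - e) * (+ 3 * (+ n * + n)) →
  e * (+ 8 * (+ n * + n)) ^ m ℤ.≤ f * + length (filter satisfiable? (formulas 3 n m))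
satisfiable-count {n} {h} m 2h≡1+n {e} {f} e>0 e≤f ratio =
  ℤ.*-cancelˡ-≤-pos _ _ K {{ℤ.positive K>0}} (begin
    K * (e * (+ 8 * nn) ^ m)
      ≡⟨ lhs ⟨
    e * (+ 2) ^ m * (∑ Fs solutions * ∑ Fs solutions)
      ≤⟨ cauchy-schwarz satisfiable? Fs solutions (unsatisfiable⇒solutions≡0 {n} {m})
           (*-nonneg (ℤ.<⇒≤ e>0) (^-nonneg {+ 2} m (+≤+ z≤n))) Q>0 bound ⟩
    f * K * N
      ≡⟨ rhs f K N ⟩
    K * (f * N) ∎)
  where
  open ℤ.≤-Reasoning
  Fs = formulas 3 n m
  N  = + length (filter satisfiable? Fs)
  nn = + n * + n
  t  = (+ 2) ^ n
  -- The factor common to both sides of the Cauchy-Schwarz bound, found from 2 · 6n² · 6n² = 9n² ·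
  -- 8n²: the squared first moment times 2ᵐ is K (8n²)ᵐ, and e 2ᵐ times the second moment is at most
  -- f K.
  K  = t * t * (+ 9 * nn) ^ m

  n>0 : 0ℤ ℤ.< + n
  n>0 = ℤ.+<+ (ℕ.>-nonZero⁻¹ n)

  t>0 : 0ℤ ℤ.< t
  t>0 = ^-pos n (ℤ.+<+ (s≤s z≤n))

  K>0 : 0ℤ ℤ.< K
  K>0 = *-pos (*-pos t>0 t>0) (^-pos m (*-pos {+ 9} (ℤ.+<+ (s≤s z≤n)) (*-pos n>0 n>0)))

  Q>0 : 0ℤ ℤ.< f * K
  Q>0 = *-pos (ℤ.<-≤-trans e>0 e≤f) K>0

  A≥0 : 0ℤ ℤ.≤ + 3 * nn
  A≥0 = *-nonneg {+ 3} (+≤+ z≤n) (square-nonneg (+ n))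

  rhs : ∀ f K N → f * K * N ≡ K * (f * N)
  rhs = solve-∀

  bound : e * (+ 2) ^ m * ∑ Fs (λ F → solutions F * solutions F) ℤ.≤ f * K
  bound = begin
    e * (+ 2) ^ m * ∑ Fs (λ F → solutions F * solutions F)
      ≡⟨ ℤ.*-assoc e ((+ 2) ^ m) _ ⟩
    e * ((+ 2) ^ m * ∑ Fs (λ F → solutions F * solutions F))
      ≡⟨ cong (e *_) (second-moment {h = h} m 2h≡1+n A≥0) ⟩
    e * (t * ((+ 3) ^ m * w))
      ≡⟨ lemma₁ e t ((+ 3) ^ m) w ⟩
    t * (+ 3) ^ m * (e * w)
      ≤⟨ *-monoʳ-≤ (*-nonneg (ℤ.<⇒≤ t>0) (^-nonneg {+ 3} m (+≤+ z≤n)))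
           (geometric-bound n (+ 3 * nn) A≥0 {M = m} (ℤ.<⇒≤ e>0) e≤f ratio m ℕ.≤-refl) ⟩
    t * (+ 3) ^ m * (f * (t * (+ 3 * nn) ^ m))
      ≡⟨ lemma₂ f t ((+ 3) ^ m) ((+ 3 * nn) ^ m) ⟩
    f * (t * t * ((+ 3) ^ m * (+ 3 * nn) ^ m))
      ≡⟨ cong (λ x → f * (t * t * x)) (trans (sym (^-distrib-* (+ 3) (+ 3 * nn) m)) (cong (_^ m) (nine (+ n)))) ⟩
    f * K ∎
    where
    w = weighted n (+ 3 * nn) A≥0 m 0
    lemma₁ : ∀ e t x w → e * (t * (x * w)) ≡ t * x * (e * w)
    lemma₁ = solve-∀
    lemma₂ : ∀ f t x y → t * x * (f * (t * y)) ≡ f * (t * t * (x * y))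
    lemma₂ = solve-∀
    nine : ∀ n → + 3 * (+ 3 * (n * n)) ≡ + 9 * (n * n)
    nine = solve-∀

  lhs : e * (+ 2) ^ m * (∑ Fs solutions * ∑ Fs solutions) ≡ K * (e * (+ 8 * nn) ^ m)
  lhs = begin-equality
    e * (+ 2) ^ m * (∑ Fs solutions * ∑ Fs solutions)
      ≡⟨ cong (λ x → e * (+ 2) ^ m * (x * x)) (first-moment n m) ⟩
    e * (+ 2) ^ m * (t * (+ 6 * nn) ^ m * (t * (+ 6 * nn) ^ m))
      ≡⟨ lemma₁ e t ((+ 2) ^ m) ((+ 6 * nn) ^ m) ⟩
    t * t * ((+ 2) ^ m * (+ 6 * nn) ^ m * (+ 6 * nn) ^ m) * e
      ≡⟨ cong (λ x → t * t * x * e) powers ⟩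
    t * t * ((+ 9 * nn) ^ m * (+ 8 * nn) ^ m) * e
      ≡⟨ lemma₂ e t ((+ 9 * nn) ^ m) ((+ 8 * nn) ^ m) ⟩
    K * (e * (+ 8 * nn) ^ m) ∎
    where
    lemma₁ : ∀ e t x y → e * x * (t * y * (t * y)) ≡ t * t * (x * y * y) * e
    lemma₁ = solve-∀
    lemma₂ : ∀ e t x y → t * t * (x * y) * e ≡ t * t * x * (e * y)
    lemma₂ = solve-∀
    seventy-two : ∀ n → + 2 * (+ 6 * (n * n)) * (+ 6 * (n * n)) ≡ + 9 * (n * n) * (+ 8 * (n * n))
    seventy-two = solve-∀
    powers : (+ 2) ^ m * (+ 6 * nn) ^ m * (+ 6 * nn) ^ m ≡ (+ 9 * nn) ^ m * (+ 8 * nn) ^ m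
    powers = begin-equality
      (+ 2) ^ m * (+ 6 * nn) ^ m * (+ 6 * nn) ^ m
        ≡⟨ cong (_* (+ 6 * nn) ^ m) (^-distrib-* (+ 2) (+ 6 * nn) m) ⟨
      (+ 2 * (+ 6 * nn)) ^ m * (+ 6 * nn) ^ m
        ≡⟨ ^-distrib-* (+ 2 * (+ 6 * nn)) (+ 6 * nn) m ⟨
      (+ 2 * (+ 6 * nn) * (+ 6 * nn)) ^ m
        ≡⟨ cong (_^ m) (seventy-two (+ n)) ⟩
      (+ 9 * nn * (+ 8 * nn)) ^ m
        ≡⟨ ^-distrib-* (+ 9 * nn) (+ 8 * nn) m ⟩
      (+ 9 * nn) ^ m * (+ 8 * nn) ^ m ∎

-- Odd primes, rational bounds and the constant

-- The witness h is the inverse of 2 modulo n on which the correlation of positions 0 and 2 relies.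
prime>2⇒odd : ∀ {n} → Prime n → 2 ℕ.< n → ∃[ h ] 2 ℕ.* h ≡ suc n
prime>2⇒odd {n} n-prime n>2 with n % 2 in n%2 | m%n<n n 2 | m≡m%n+[m/n]*n n 2
... | 0 | _ | _ with prime⇒irreducible n-prime (m%n≡0⇒n∣m n 2 n%2)
...   | inj₂ refl = contradiction n>2 (ℕ.<-irrefl refl)
prime>2⇒odd {n} n-prime n>2 | 1 | _ | n≡1+2k = suc (n / 2) , trans (lemma (n / 2)) (cong suc (sym n≡1+2k))
  where
  lemma : ∀ k → 2 ℕ.* suc k ≡ suc (1 ℕ.+ k ℕ.* 2)
  lemma = ℕ-solver.solve-∀
prime>2⇒odd {n} n-prime n>2 | suc (suc _) | s≤s (s≤s ()) | _

/-mono-≤ : ∀ {i j a b} .{{_ : NonZero a}} .{{_ : NonZero b}} → i * + b ℤ.≤ j * + a → i ℚ./ a ℚ.≤ j ℚ./ b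
/-mono-≤ {i} {j} {suc a} {suc b} ib≤ja = ℚ.toℚᵘ-cancel-≤
  (ℚᵘ.≤-respˡ-≃ (ℚᵘ.≃-sym (ℚ.toℚᵘ-fromℚᵘ (mkℚᵘ i a)))
    (ℚᵘ.≤-respʳ-≃ (ℚᵘ.≃-sym (ℚ.toℚᵘ-fromℚᵘ (mkℚᵘ j b))) (*≤* ib≤ja)))

≤-Pr : ∀ {A : Set} {P : A → Set} (Ω : List A) .{{_ : NonZero (length Ω)}} (P? : Decidable P) i a .{{_ : NonZero a}} →
       i * + length Ω ℤ.≤ + a * + length (filter P? Ω) → i ℚ./ a ℚ.≤ Pr Ω P?
≤-Pr Ω P? i a i|Ω|≤aN = /-mono-≤ {i} {+ length (filter P? Ω)} {a} {length Ω}
  (subst (i * + length Ω ℤ.≤_) (ℤ.*-comm (+ a) (+ length (filter P? Ω))) i|Ω|≤aN)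

/-pos : ∀ {i a} .{{_ : NonZero a}} → 0ℤ ℤ.< i → 0ℚ ℚ.< i ℚ./ a
/-pos {+ suc i} {a} _ = ℚ.positive⁻¹ _ {{ℚ.normalize-pos (suc i) a}}
/-pos {+ zero} (ℤ.+<+ ())

-- This is m ≤ ρn with denominators cleared. If ρn < m, then m ≤ rn puts ρn into the lower cut of
-- rn; dividing by n puts ρ into the lower cut of r, although ρ lies in the upper one.
floor⇒≤ : ∀ {r : ℝ} {ρ} n m .{{_ : NonZero n}} → ℝ.U r ρ → m IsFloorOf (r · (+ n ℚ./ 1)) →
          + m * ↧ ρ ℤ.≤ ↥ ρ * + n
floor⇒≤ {r} {ρ@record{}} n m ρ∈U (m≤rn , _) = subst₂ ℤ._≤_
  (cong (+ m *_) (ℤ.*-identityʳ (↧ ρ))) (ℤ.*-identityʳ (↥ ρ * + n)) (ℚᵘ.drop-*≤* m≤ρn)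
  where
  s = + n ℚ./ 1
  instance
    s≢0 : ℚ.NonZero s
    s≢0 = ℚ.pos⇒nonZero s

  m≤ρs : + m ℚ./ 1 ℚ.≤ ρ ℚ.* s
  m≤ρs = ℚ.≮⇒≥ λ ρs<m → ℝ.disjoint r
    (subst (ℝ.L r) (trans (ℚ.*-assoc ρ s (1/ s)) (trans (cong (ρ ℚ.*_) (ℚ.*-inverseʳ s)) (ℚ.*-identityʳ ρ)))
      (m≤rn ρs<m))
    ρ∈U

  m≤ρn : mkℚᵘ (+ m) 0 ℚᵘ.≤ toℚᵘ ρ ℚᵘ.* mkℚᵘ (+ n) 0
  m≤ρn = ℚᵘ.≤-respˡ-≃ (ℚ.toℚᵘ-fromℚᵘ (mkℚᵘ (+ m) 0))
    (ℚᵘ.≤-respʳ-≃ (ℚᵘ.≃-trans (ℚ.toℚᵘ-homo-* ρ s) (ℚᵘ.*-congˡ {toℚᵘ ρ} (ℚ.toℚᵘ-fromℚᵘ (mkℚᵘ (+ n) 0))))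
      (ℚ.toℚᵘ-mono-≤ m≤ρs))

U-above-0⇒pos : ∀ {r : ℝ} {ρ} → fromℚ 0ℚ < r → ℝ.U r ρ → 0ℚ ℚ.< ρ
U-above-0⇒pos {r} (q , 0<q , q∈L) ρ∈U =
  ℚ.<-≤-trans 0<q (ℚ.≮⇒≥ λ ρ<q → ℝ.disjoint r (ℝ.L-down r ρ<q q∈L) ρ∈U)

corollary3 : (r : ℝ) → fromℚ 0ℚ < r → r < fromℚ (+ 3 ℚ./ 2) →
    ∃[ c ] fromℚ 0ℚ < c ×
    (∀ n .{{_ : NonZero n}} → Prime n → 3 ℕ.< n →
    ∀ m → m IsFloorOf (r · (+ n ℚ./ 1)) →
    c ≤ fromℚ (Pr-satisfiable 3 n m))
corollary3 r r>0 (ρ , ρ∈U , ρ<3/2) =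
  -- The order on cuts asks for a rational strictly between 0 and c, and c ≤ Pr is tested on every
  -- rational q < c.
  fromℚ c , ℚ.<-dense c>0 , λ n n-prime n>3 m m-floor q<c → ℚ.<-≤-trans q<c (c≤Pr n n-prime n>3 m m-floor)
  where
  -- With ρ = p / d this makes c = (3d - 2p) / 3d = 1 - 2ρ/3, which is positive exactly because ρ <
  -- 3/2.
  e = + 3 * ↧ ρ + - (+ 2 * ↥ ρ)
  f = 3 ℕ.* ↧ₙ ρ
  c = e ℚ./ f

  e>0 : 0ℤ ℤ.< e
  e>0 = subst (ℤ._< e) (ℤ.+-inverseʳ (+ 2 * ↥ ρ)) (ℤ.+-monoˡ-< (- (+ 2 * ↥ ρ))
    (subst (ℤ._< + 3 * ↧ ρ) (ℤ.*-comm (↥ ρ) (+ 2)) (ℚ.drop-*<* ρ<3/2)))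

  c>0 : 0ℚ ℚ.< c
  c>0 = /-pos e>0

  ↥ρ≥0 : 0ℤ ℤ.≤ ↥ ρ
  ↥ρ≥0 = ℤ.<⇒≤ (subst (0ℤ ℤ.<_) (ℤ.*-identityʳ (↥ ρ)) (ℚ.drop-*<* (U-above-0⇒pos {r} r>0 ρ∈U)))

  e≤f : e ℤ.≤ + f
  e≤f = ≤-from-diff (*-nonneg {+ 2} (+≤+ z≤n) ↥ρ≥0) (trans (ℤ.pos-* 3 (↧ₙ ρ)) (lemma (↧ ρ) (↥ ρ)))
    where
    lemma : ∀ d p → + 3 * d ≡ + 3 * d + - (+ 2 * p) + + 2 * p
    lemma = solve-∀

  module _ (n : ℕ) .{{_ : NonZero n}} (n-prime : Prime n) (n>3 : 3 ℕ.< n)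
           (m : ℕ) (m-floor : m IsFloorOf (r · (+ n ℚ./ 1))) where

    -- Since f = 3d and f - e = 2p, this is the inequality m d ≤ p n from `floor⇒≤` multiplied by
    -- 6n.
    ratio : + 2 * + n * + m * + f ℤ.≤ (+ f + - e) * (+ 3 * (+ n * + n))
    ratio = subst₂ ℤ._≤_
      (trans (lemma₁ (+ n) (+ m) (↧ ρ)) (cong (+ 2 * + n * + m *_) (sym (ℤ.pos-* 3 (↧ₙ ρ)))))
      (trans (lemma₂ (+ n) (↧ ρ) (↥ ρ)) (cong (λ x → (x + - e) * (+ 3 * (+ n * + n))) (sym (ℤ.pos-* 3 (↧ₙ ρ)))))
      (*-monoʳ-≤ {+ 6 * + n} (*-nonneg {+ 6} {+ n} (+≤+ z≤n) (+≤+ z≤n)) (floor⇒≤ {r} n m ρ∈U m-floor))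
      where
      lemma₁ : ∀ n m d → + 6 * n * (m * d) ≡ + 2 * n * m * (+ 3 * d)
      lemma₁ = solve-∀
      lemma₂ : ∀ n d p → + 6 * n * (p * n) ≡ (+ 3 * d + - (+ 3 * d + - (+ 2 * p))) * (+ 3 * (n * n))
      lemma₂ = solve-∀

    length-Ω : + length (formulas 3 n m) ≡ (+ 8 * (+ n * + n)) ^ m
    length-Ω = trans (cong +_ (length-formulas 3 n m)) (trans (pos-^ (n ℕ.* (n ℕ.* 8)) m)
      (cong (_^ m) (trans (ℤ.pos-* n (n ℕ.* 8)) (trans (cong (+ n *_) (ℤ.pos-* n 8)) (lemma (+ n))))))
      where
      lemma : ∀ n → n * (n * + 8) ≡ + 8 * (n * n)
      lemma = solve-∀

    c≤Pr : c ℚ.≤ Pr-satisfiable 3 n m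
    c≤Pr =
      let h , 2h≡1+n = prime>2⇒odd n-prime (ℕ.<-trans ℕ.≤-refl n>3) in
      ≤-Pr (formulas 3 n m) {{formulas≢0 3 n m}} satisfiable? e f
        (subst (λ x → e * x ℤ.≤ + f * + length (filter satisfiable? (formulas 3 n m))) (sym length-Ω)
          (satisfiable-count {h = h} m 2h≡1+n e>0 e≤f ratio))
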